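{- For any formula $\phi(\mathbf{x},\mathbf{y})$, $\mathrm{VCm}(\phi) = \mathrm{VCd}_{\mathrm{ind}}(\phi)$.
   Context: Fix a complete first-order theory $T$ with a large saturated (monster, in particular infinite) model $\mathfrak{M}$ with universe $\mathrm{M}$. Formulas are partitioned, $\phi(\mathbf{x},\mathbf{y})$, with $\mathbf{x}=\langle x_1,\ldots,x_l\rangle$ and $\mathbf{y}=\langle y_1,\ldots,y_k\rangle$ finite nonempty tuples of variables; $|\mathbf{x}|=l$, $|\mathbf{y}|=k$. For $A\subseteq \mathrm{M}^{|\mathbf{y}|}$, $S_\phi(A)$ is the set of $\phi$-types over $A$, i.e. maximal consistent sets of formulas of the form $\pm\phi(\mathbf{x},\mathbf{a})$, $\mathbf{a}\in A$. A type $p\in S_\phi(A)$ is identified with the subset $\{\mathbf{a}\in A:\phi(\mathbf{x},\mathbf{a})\in p\}$ of $A$, so $S_\phi(A)\subseteq\mathcal{P}(A)$. Maximum set systems: for a set $X$, $\mathcal{C}\subseteq\mathcal{P}(X)$ and $A\subseteq X$, let $\mathcal{C}|^A=\{C\cap A: C\in\mathcal{C}\}$. For $d\in\omega$, $\mathcal{C}$ is $d$-maximum (on $X$) if for every finite $A\subseteq X$, $|\mathcal{C}|^A|=\binom{|A|}{\leq d}$, where $\binom{n}{\leq k}$ denotes $\sum_{i=0}^k\binom{n}{i}$ if $k<n$ and $2^n$ otherwise. Traces: for $A\subseteq \mathrm{M}^{|\mathbf{y}|}$, $Tr(\phi,A)=\mathcal{P}(S_\phi(A))$, so an element $\mathcal{C}$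 of $Tr(\phi,A)$ is a family of subsets of $A$ (regarded as a set system on $A$). For a cardinal $\kappa$, $Tr_\kappa(\phi)=\bigcup\{Tr(\phi,A): A\subseteq \mathrm{M}^{|\mathbf{y}|}, |A|=\kappa\}$. $\mathrm{VCm}(\phi)$ is the maximum of the $d\in\omega$ such that some $\mathcal{C}\in Tr_{\aleph_0}(\phi)$ is $d$-maximum (on the corresponding countably infinite set $A$), and $\mathrm{VCm}(\phi)=\infty$ if there are arbitrarily large such $d$. For $r\in\mathbb{R}$, $\mathrm{VCd}_{\mathrm{ind}}(\phi)\leq r$ means: there is $K\in\omega$ such that for every nonempty finite indiscernible sequence $\bar{\mathbf{b}}=\langle\mathbf{b}_i:i<N\rangle$ of elements of $\mathrm{M}^{|\mathbf{y}|}$, $|S_\phi(\mathrm{range}(\bar{\mathbf{b}}))|<K\cdot N^r$. $\mathrm{VCd}_{\mathrm{ind}}(\phi)$ is the infimum of all such $r$, and is $\infty$ if there is none. -}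

module Defs where

open import Data.Bool.Base using (if_then_else_)
open import Data.Empty using (⊥)
open import Data.Fin.Base as Fin using (Fin)
open import Data.Integer.Base using (+_; -[1+_])
import Data.List.Base as List
open import Data.List.Relation.Unary.All using () renaming (All to Allᴸ)
open import Data.Nat.Base
  using (ℕ; suc; _+_; _*_; _^_; _<ᵇ_; NonZero)
  renaming (_≤_ to _≤ᴺ_; _<_ to _<ᴺ_)
open import Data.Nat.Combinatorics using (_C_)
open import Data.Nat.ListAction using (sum)
open import Data.Product.Base using (Σ-syntax; ∃; _×_; _,_; proj₁)
open import Data.Rational using (ℚ; _<_; _/_; ↥_; ↧ₙ_; 1ℚ)
import Data.Rational as ℚ
import Data.Rational.Properties as ℚ
open import Data.Sum.Base using (_⊎_)
open import Data.Vec.Base using (Vec; []; _∷_; [_]; _++_; concat; lookup; tabulate)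
open import Data.Vec.Relation.Unary.All using (All)
open import Function.Bundles using (Bijection; Injection; _⇔_)
open import Function.Base using (_∘_)
open import Level using (Level; 0ℓ; _⊔_) renaming (suc to lsuc)
open import Relation.Binary.Bundles using (Setoid)
open import Relation.Binary.Core using (_Preserves_⟶_)
import Relation.Binary.Construct.On as On
open import Relation.Binary.PropositionalEquality using (_≡_; setoid)
open import Relation.Nullary.Construct.Add.Supremum using (_⁺; ⊤⁺)
  renaming ([_] to fin)
open import Relation.Nullary.Negation.Core using (¬_)
open import Relation.Unary using (Pred; _∈_; _∉_; _⊆_; _∩_; _≐_)
open import Relation.Unary.Relation.Binary.Equality using (≐-setoid)

private
  variable
    a b c ℓ ℓ′ : Level

------------------------------------------------------------------------
-- Cardinality

_∣ˢ_ : (S : Setoid a b) → Pred (Setoid.Carrier S) c → Setoid (a ⊔ c) b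
S ∣ˢ A = On.setoid S (proj₁ {B = A})

-- |S| < |T|, for the sets of equivalence classes of S and T.
_≺_ : Setoid a b → Setoid ℓ ℓ′ → Set _
S ≺ T = Injection S T × ¬ Injection T S

-- A cardinal is represented by a type I having that many elements:
-- Fin n for n, and ℕ for ℵ₀.
HasCard : (S : Setoid a b) → Pred (Setoid.Carrier S) c → Set → Set _
HasCard S A I = Bijection (setoid I) (S ∣ˢ A)

SubsetHasCard : {X : Set a} → Pred X c → Set → Set _
SubsetHasCard {X = X} = HasCard (setoid X)

-- Subsets of X are predicates, and two of them count as the same subset
-- when they have the same elements.
FamilyHasCard : {X : Set a} → Pred (Pred X b) c → Set → Set _
FamilyHasCard {b = b} {X = X} = HasCard (≐-setoid X b)

------------------------------------------------------------------------
-- Maximum set systems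

_choose≤_ : ℕ → ℕ → ℕ
n choose≤ k =
  if k <ᵇ n then sum (List.map (n C_) (List.upTo (suc k))) else 2 ^ n

Restrict : {X : Set a} → Pred (Pred X b) c → Pred X b → Pred (Pred X b) _
Restrict 𝒞 A Z = ∃ λ Y → Y ∈ 𝒞 × Z ≐ (Y ∩ A)

IsMaximumOn : {Y : Set a} → Pred Y b → ℕ → Pred (Pred Y b) c → Set _
IsMaximumOn {b = b} {Y = Y} X d 𝒞 =
  (A : Pred Y b) (n : ℕ) → A ⊆ X → SubsetHasCard A (Fin n) →
  FamilyHasCard (Restrict 𝒞 A) (Fin (n choose≤ d))

------------------------------------------------------------------------
-- Real numbers

-- Dedekind cuts given by their lower halves, as in classical analysis.
-- There is no locatedness condition, so this is the set of real numbers
-- only in the presence of excluded middle.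
record ℝ : Set₁ where
  field
    lower     : Pred ℚ 0ℓ
    inhabited : ∃ λ q → q ∈ lower
    proper    : ∃ λ q → q ∉ lower
    downward  : ∀ {p q} → p < q → q ∈ lower → p ∈ lower
    rounded   : ∀ {p} → p ∈ lower → ∃ λ q → p < q × q ∈ lower

open ℝ

_≤ᴿ_ : ℝ → ℝ → Set
x ≤ᴿ y = lower x ⊆ lower y

fromℚ : ℚ → ℝ
fromℚ p = record
  { lower     = _< p
  ; inhabited = p ℚ.- 1ℚ , lemma
  ; proper    = p , ℚ.<-irrefl _≡_.refl
  ; downward  = ℚ.<-trans
  ; rounded   = λ q<p → let m , q<m , m<p = ℚ.<-dense q<p in m , q<m , m<p
  }
  where
  open ℚ.≤-Reasoning
  lemma : p ℚ.- 1ℚ < p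
  lemma = begin-strict
    p ℚ.- 1ℚ  <⟨ ℚ.+-monoʳ-< p (ℚ.negative⁻¹ (ℚ.- 1ℚ)) ⟩
    p ℚ.+ ℚ.0ℚ ≡⟨ ℚ.+-identityʳ p ⟩
    p          ∎

fromℕ : ℕ → ℝ
fromℕ n = fromℚ (+ n / 1)

fromℕ⁺ : ℕ ⁺ → ℝ ⁺
fromℕ⁺ (fin n) = fin (fromℕ n)
fromℕ⁺ ⊤⁺      = ⊤⁺

-- s < K · N ^ q for N ≥ 1 and q = n/m with m > 0: both sides are raised
-- to the power m, and a negative power of N is moved to the left.
_<_·_^ℚ_ : ℕ → ℕ → ℕ → ℚ → Set
s < K · N ^ℚ q with ↥ q
... | + n      = s ^ ↧ₙ q <ᴺ K ^ ↧ₙ q * N ^ n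
... | -[1+ n ] = s ^ ↧ₙ q * N ^ suc n <ᴺ K ^ ↧ₙ q

-- s < K · N ^ r for N ≥ 1 and r real, where N ^ r is the supremum of
-- N ^ q over the rationals q < r.
_<_·_^ᴿ_ : ℕ → ℕ → ℕ → ℝ → Set
s < K · N ^ᴿ r = ∃ λ q → q ∈ lower r × s < K · N ^ℚ q

-- Here inf ∅ = ∞; a nonempty P unbounded below has no infimum.
IsInfimum : Pred ℝ ℓ → ℝ ⁺ → Set _
IsInfimum P (fin v) =
  (∀ r → r ∈ P → v ≤ᴿ r) × (∀ w → (∀ r → r ∈ P → w ≤ᴿ r) → w ≤ᴿ v)
IsInfimum P ⊤⁺      = Level.Lift (lsuc 0ℓ) (∀ r → r ∉ P)

-- The value is ∞ when P has arbitrarily large elements.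
IsMaximum : Pred ℕ ℓ → ℕ ⁺ → Set _
IsMaximum P (fin d) = d ∈ P × (∀ e → e ∈ P → e ≤ᴺ d)
IsMaximum P ⊤⁺      = ∀ n → ∃ λ d → n ≤ᴺ d × d ∈ P

------------------------------------------------------------------------
-- First-order logic with equality

record Language (ℓ : Level) : Set (lsuc ℓ) where
  field
    Fun : ℕ → Set ℓ
    Rel : ℕ → Set ℓ

module _ (L : Language ℓ) where
  open Language L

  data Term (n : ℕ) : Set ℓ where
    var : Fin n → Term n
    app : ∀ {k} → Fun k → Vec (Term n) k → Term n

  -- Formula n: formulas with free variables among 0, …, n - 1; the
  -- quantifier binds variable 0.
  data Formula : ℕ → Set ℓ where
    _≈′_ : ∀ {n} → Term n → Term n → Formula n
    rel  : ∀ {n k} → Rel k → Vec (Term n) k → Formula n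
    ⊥′   : ∀ {n} → Formula n
    _⇒_  : ∀ {n} → Formula n → Formula n → Formula n
    ∀′_  : ∀ {n} → Formula (suc n) → Formula n

  Theory : Set (lsuc ℓ)
  Theory = Pred (Formula 0) ℓ

  record Structure : Set (lsuc ℓ) where
    field
      Carrier  : Set ℓ
      nonempty : Carrier
      fun      : ∀ {k} → Fun k → Vec Carrier k → Carrier
      relation : ∀ {k} → Rel k → Pred (Vec Carrier k) ℓ

module _ {L : Language ℓ} where

  ¬′_ : ∀ {n} → Formula L n → Formula L n
  ¬′ φ = φ ⇒ ⊥′

  module Semantics (M : Structure L) where
    open Structure M

    mutual
      eval : ∀ {n} → Vec Carrier n → Term L n → Carrier
      eval ρ (var i)    = lookup ρ i
      eval ρ (app f ts) = fun f (evals ρ ts)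

      evals : ∀ {n k} → Vec Carrier n → Vec (Term L n) k → Vec Carrier k
      evals ρ []       = []
      evals ρ (t ∷ ts) = eval ρ t ∷ evals ρ ts

    Sat : ∀ {n} → Formula L n → Vec Carrier n → Set ℓ
    Sat (s ≈′ t)   ρ = eval ρ s ≡ eval ρ t
    Sat (rel R ts) ρ = relation R (evals ρ ts)
    Sat ⊥′         ρ = Level.Lift ℓ ⊥
    Sat (φ ⇒ ψ)    ρ = Sat φ ρ → Sat ψ ρ
    Sat (∀′ φ)     ρ = ∀ m → Sat φ (m ∷ ρ)

  _⊨_ : Structure L → Theory L → Set ℓ
  M ⊨ T = ∀ {σ} → σ ∈ T → Semantics.Sat M σ []

  _⊩_ : Theory L → Formula L 0 → Set (lsuc ℓ)
  T ⊩ σ = ∀ (M : Structure L) → M ⊨ T → Semantics.Sat M σ []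

  -- Consistency of T is left to the existence of a model.
  Complete : Theory L → Set (lsuc ℓ)
  Complete T = ∀ σ → (T ⊩ σ) ⊎ (T ⊩ (¬′ σ))

------------------------------------------------------------------------
-- Formulas with parameters, types, and monster models

module _ {L : Language ℓ} (M : Structure L) where
  open Structure M
  open Semantics M

  -- (m , ψ , 𝐚) is the formula ψ(x₀,…,xₙ₋₁,𝐚), with parameters 𝐚 ∈ Mᵐ.
  Formulaᴹ : ℕ → Set ℓ
  Formulaᴹ n = Σ[ m ∈ ℕ ] (Formula L (n + m) × Vec Carrier m)

  Satᴹ : ∀ {n} → Vec Carrier n → Formulaᴹ n → Set ℓ
  Satᴹ 𝐜 (_ , ψ , 𝐚) = Sat ψ (𝐜 ++ 𝐚)

  Over : ∀ {n} → Pred Carrier ℓ → Pred (Formulaᴹ n) ℓ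
  Over A (_ , _ , 𝐚) = All A 𝐚

  -- Consistency with the elementary diagram of M, that is, finite
  -- satisfiability in M.
  Consistent : ∀ {n} → Pred (Formulaᴹ n) ℓ → Set ℓ
  Consistent p = ∀ θs → Allᴸ p θs → ∃ λ 𝐜 → Allᴸ (Satᴹ 𝐜) θs

  Saturated : Set (lsuc ℓ)
  Saturated =
    (A : Pred Carrier ℓ) → (setoid Carrier ∣ˢ A) ≺ setoid Carrier →
    (p : Pred (Formulaᴹ 1) ℓ) → p ⊆ Over A → Consistent p →
    ∃ λ c → p ⊆ Satᴹ [ c ]

  record IsMonster : Set (lsuc ℓ) where
    field
      -- |L| + ℵ₀ < |M|; in particular M is infinite.
      large     : setoid (∃ (Formula L)) ≺ setoid Carrier
      saturated : Saturated

  Indiscernible : ∀ {k N} → (Fin N → Vec Carrier k) → Set ℓ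
  Indiscernible {k} {N} 𝐛 =
    ∀ n (ψ : Formula L (n * k)) (i j : Fin n → Fin N) →
    i Preserves Fin._<_ ⟶ Fin._<_ → j Preserves Fin._<_ ⟶ Fin._<_ →
    Sat ψ (concat (tabulate (𝐛 ∘ i))) ⇔ Sat ψ (concat (tabulate (𝐛 ∘ j)))

  range : ∀ {k N} → (Fin N → Vec Carrier k) → Pred (Vec Carrier k) ℓ
  range 𝐛 𝐚 = ∃ λ i → 𝐛 i ≡ 𝐚

  -- In φ(𝐱,𝐲) : Formula L (l + k), 𝐱 is the first l variables and 𝐲 the
  -- remaining k.
  module _ (l k : ℕ) (φ : Formula L (l + k)) where

    φ⁺ φ⁻ : Vec Carrier k → Formulaᴹ l
    φ⁺ 𝐚 = k , φ , 𝐚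
    φ⁻ 𝐚 = k , (¬′ φ) , 𝐚

    ±φ : Pred (Vec Carrier k) ℓ → Pred (Formulaᴹ l) ℓ
    ±φ A θ = ∃ λ 𝐚 → 𝐚 ∈ A × (θ ≡ φ⁺ 𝐚 ⊎ θ ≡ φ⁻ 𝐚)

    record IsφType (A : Pred (Vec Carrier k) ℓ)
                   (p : Pred (Formulaᴹ l) ℓ) : Set (lsuc ℓ) where
      field
        overA      : p ⊆ ±φ A
        consistent : Consistent p
        maximal    : ∀ (q : Pred (Formulaᴹ l) ℓ) →
                     q ⊆ ±φ A → Consistent q → p ⊆ q → q ⊆ p

    -- S_φ(A), each type p being identified with {𝐚 ∈ A : φ(𝐱,𝐚) ∈ p}.
    Sφ : Pred (Vec Carrier k) ℓ → Pred (Pred (Vec Carrier k) ℓ) (lsuc ℓ)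
    Sφ A X = ∃ λ p → IsφType A p × X ≐ (λ 𝐚 → 𝐚 ∈ A × φ⁺ 𝐚 ∈ p)

    Tr : Pred (Vec Carrier k) ℓ →
         Pred (Pred (Pred (Vec Carrier k) ℓ) (lsuc ℓ)) (lsuc ℓ)
    Tr A 𝒞 = 𝒞 ⊆ Sφ A

    IsVCm : ℕ ⁺ → Set (lsuc (lsuc ℓ))
    IsVCm = IsMaximum λ d →
      ∃ λ A → SubsetHasCard A ℕ ×
      (∃ λ 𝒞 → 𝒞 ∈ Tr A × IsMaximumOn A d 𝒞)

    VCdInd≤ : Pred ℝ (lsuc ℓ)
    VCdInd≤ r =
      ∃ λ K → ∀ N .{{_ : NonZero N}} (𝐛 : Fin N → Vec Carrier k) →
      Indiscernible 𝐛 →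
      ∃ λ s → FamilyHasCard (Sφ (range 𝐛)) (Fin s) × s < K · N ^ᴿ r

    IsVCdInd : ℝ ⁺ → Set (lsuc ℓ)
    IsVCdInd = IsInfimum VCdInd≤

{-# OPTIONS --safe #-}
module Submission where

-- Along a sequence (bᵢ) an element c has a truth pattern, the 0-1 word of the
-- truth values of φ(c,bᵢ). Exactly n choose≤ d words of length n avoid a given
-- word u of length d + 1 as a scattered subword, so if all words avoiding u
-- occur along an infinite sequence, they form a d-maximum family.
--
-- Along an indiscernible sequence, the words of length n occurring on n of its
-- members do not depend on the choice of these members. If one pattern contains
-- a₀ⁿ ā₀ a₁ⁿ ā₁ … aₑⁿ, then it contains every word of length n avoiding
-- u = ā₀ … āₑ, and so all of these occur. Without a (d+1)-maximum family,
-- saturation excludes this for e = d + 1 and some n, and only O(N^d) words of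
-- length N contain no such word.
--
-- Conversely, Ramsey's theorem and saturation turn a d-maximum family into
-- indiscernible sequences of every length N with at least N choose≤ d types.

open import Defs
open import Axiom.ExcludedMiddle using (ExcludedMiddle)
open import Data.Bool.Base using (Bool; true; false; not; if_then_else_; T)
open import Data.Bool.Properties using (if-eta) renaming (_≟_ to _≟ᵇ_)
open import Data.Fin.Base as Fin using (Fin; zero; suc; toℕ; inject≤; _↑ˡ_; _↑ʳ_)
open import Data.Fin.Properties using (injective⇒≤; toℕ-inject≤; toℕ-injective; ℕ→Fin-notInjective)
open import Data.Integer.Base as ℤ using (+_; -[1+_])
import Data.Integer.Properties as ℤ
import Data.Integer.Solver as ℤSolver
open import Data.List.Base as List
  using (List; []; _∷_; length; allFin; filter; applyUpTo; applyDownFrom; reverse; catMaybes; replicate)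
  renaming (_++_ to _++ᴸ_; lookup to lookupᴸ; map to mapᴸ; tabulate to tabulateᴸ)
open import Data.List.Membership.Propositional using () renaming (_∈_ to _∈ᴸ_)
open import Data.List.Membership.Propositional.Properties
  using (∈-lookup; ∈-filter⁺; ∈-filter⁻; ∈-map⁺; ∈-map⁻; ∈-++⁺ˡ; ∈-++⁺ʳ; ∈-++⁻; ∈-allFin;
         ∈-applyUpTo⁺)
open import Data.List.Properties
  using (length-map; length-replicate; length-++; length-tabulate; length-filter; length-reverse;
         ∷-injectiveˡ; ∷-injectiveʳ; map-upTo; reverse-applyUpTo; reverse-involutive)
open import Data.List.Relation.Binary.Sublist.Propositional
  using ([]; _∷_; _∷ʳ_; ⊆-trans; minimum; from∈)
  renaming (_⊆_ to _⊑_)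
open import Data.List.Relation.Binary.Sublist.Propositional.Properties
  using (∷⁻; ∷ʳ⁻; length-mono-≤; reverse⁺) renaming (++⁺ˡ to ⊑-++ˡ)
import Data.List.Relation.Unary.All as Allᴸ
open import Data.List.Relation.Unary.All using ([]; _∷_) renaming (All to Allᴸ)
import Data.List.Relation.Unary.All.Properties as Allᴸ
open import Data.List.Relation.Unary.AllPairs using ([]; _∷_)
open import Data.List.Relation.Unary.Any using (here; there; index)
open import Data.List.Relation.Unary.Any.Properties using (lookup-index)
open import Data.List.Relation.Unary.Unique.Propositional using (Unique)
import Data.List.Relation.Unary.Unique.Propositional.Properties as Unique
open import Data.Maybe.Base using (Maybe; just; nothing)
open import Data.Nat.Base
  using (ℕ; zero; suc; _+_; _*_; _^_; _∸_; _⊔_; _≤_; _<_; _<ᵇ_; z≤n; s≤s; s≤s⁻¹; NonZero)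
open import Data.Nat.Combinatorics using (_C_; nCk+nC[k+1]≡[n+1]C[k+1]; k>n⇒nCk≡0)
open import Data.Nat.Coprimality using (1-coprimeTo) renaming (sym to coprime-sym)
open import Data.Nat.ListAction using (sum)
open import Data.Nat.Properties
open import Data.Nat.Solver using (module +-*-Solver)
open import Data.Product.Base using (∃; ∃₂; Σ; _×_; _,_; proj₁; proj₂)
open import Data.Rational as ℚ using (ℚ; mkℚ; ↥_; ↧_; ↧ₙ_)
import Data.Rational.Properties as ℚ
open import Data.Sum.Base using (_⊎_; inj₁; inj₂)
open import Data.Unit.Base using (⊤; tt)
open import Data.Vec.Base as Vec
  using (Vec; []; _∷_; [_]; _++_; concat; lookup; tabulate; toList)
open import Data.Vec.Membership.Propositional using () renaming (_∈_ to _∈ⱽ_)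
open import Data.Vec.Properties
  using (map-∘; map-cong; map-++; map-concat; lookup-++ˡ; lookup-++ʳ; lookup-concat; lookup∘tabulate;
         tabulate-∘; tabulate-cong; tabulate∘lookup; length-toList)
open import Data.Vec.Relation.Unary.All as All using (All; []; _∷_)
open import Data.Vec.Relation.Unary.Any using (here; there) renaming (index to indexⱽ)
open import Data.Vec.Relation.Unary.Any.Properties using () renaming (lookup-index to lookup-indexⱽ)
open import Function.Base using (_∘_; id)
open import Function.Bundles using (Bijection; Injection; _⇔_; mk⇔; module Equivalence)
open import Function.Definitions using (Injective)
open import Level using (Level; 0ℓ; lift; lower) renaming (suc to lsuc)
open import Relation.Binary.Bundles using (Setoid)
open import Relation.Binary.Core using (_Preserves_⟶_)
open import Relation.Binary.Definitions using (tri<; tri≈; tri>)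
open import Relation.Binary.PropositionalEquality
  using (_≡_; _≢_; refl; sym; trans; cong; cong₂; subst; subst₂; setoid; module ≡-Reasoning)
open import Relation.Nullary.Construct.Add.Supremum using (⊤⁺) renaming ([_] to fin)
open import Relation.Nullary.Decidable.Core using (Dec; yes; no; does; decidable-stable)
open import Relation.Nullary.Negation.Core using (¬_; contradiction)
open import Relation.Unary using (Pred; _∈_; _∉_; _⊆_; _≐_; _∩_)
open import Relation.Unary.Relation.Binary.Equality using (≐-setoid)

open Equivalence using (to; from)


-- Words avoiding a scattered subword

-- The exponent d comes from the following count. Take e = d + 1. A word without such a subword is
-- read in rounds: at most 2n letters until one letter has occurred n times, then a run of that
-- letter until the other one appears. There are at most d + 1 runs, and what follows the last of
-- them is shorter than 2n. The total length N fixes one run length, so d of them remain free.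
-- Saturation is applied to types in finitely many variables over finite tuples, so it does not
-- yield an infinite sequence in one step. The sequence is built member by member, and the invariant
-- is that the tuple built so far extends by any finite number of members. For indiscernible
-- sequences one type is enough, because the density looks only at finite ones. A maximum family
-- needs distinct parameters. In the limit sequence two members are told apart by a pattern with
-- different letters at their positions, and such a pattern exists once u has at least two letters.
-- The 0-maximum family, which makes the set of possible d nonempty, therefore has a construction of
-- its own.

Avoids : List Bool → List Bool → Set
Avoids u w = ¬ u ⊑ w

not-≢ : ∀ {x y} → y ≢ x → y ≡ not x
not-≢ {x} {y} y≢x with y | x
... | true  | true  = contradiction refl y≢x
... | true  | false = refl
... | false | true  = refl
... | false | false = contradiction refl y≢x

not≢ : ∀ x → not x ≢ x
not≢ true  ()
not≢ false ()

avoids-fresh : ∀ {x y u w} → y ≢ x → Avoids (x ∷ u) w → Avoids (x ∷ u) (y ∷ w)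
avoids-fresh y≢x avoid sub = avoid (∷ʳ⁻ (y≢x ∘ sym) sub)

avoids-fresh⁻ : ∀ {x y u w} → Avoids (x ∷ u) (y ∷ w) → Avoids (x ∷ u) w
avoids-fresh⁻ avoid = avoid ∘ (_ ∷ʳ_)

avoids-match : ∀ {x u w} → Avoids u w → Avoids (x ∷ u) (x ∷ w)
avoids-match avoid = avoid ∘ ∷⁻

avoids-match⁻ : ∀ {x u w} → Avoids (x ∷ u) (x ∷ w) → Avoids u w
avoids-match⁻ avoid = avoid ∘ (refl ∷_)

-- The two branches follow the greedy search for u: the letter x advances it to the rest of u, the
-- other letter leaves it where it is. The number of words thus obeys Pascal's rule and depends on u
-- only through its length.
avoiding : List Bool → ℕ → List (List Bool)
avoiding []      n       = []
avoiding (x ∷ u) zero    = [] ∷ []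
avoiding (x ∷ u) (suc n) =
  mapᴸ (x ∷_) (avoiding u n) ++ᴸ mapᴸ (not x ∷_) (avoiding (x ∷ u) n)

avoiding-complete : ∀ u w → Avoids u w → w ∈ᴸ avoiding u (length w)
avoiding-complete []      w       avoid = contradiction (minimum w) avoid
avoiding-complete (x ∷ u) []      avoid = here refl
avoiding-complete (x ∷ u) (y ∷ w) avoid with y ≟ᵇ x
... | yes refl = ∈-++⁺ˡ (∈-map⁺ (x ∷_) (avoiding-complete u w (avoids-match⁻ avoid)))
... | no  y≢x with refl ← not-≢ y≢x =
  ∈-++⁺ʳ (mapᴸ (x ∷_) (avoiding u (length w)))
    (∈-map⁺ (not x ∷_) (avoiding-complete (x ∷ u) w (avoids-fresh⁻ avoid)))

avoiding-sound : ∀ u n {w} → w ∈ᴸ avoiding u n → Avoids u w × length w ≡ n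
avoiding-sound (x ∷ u) zero    (here refl) = (λ ()) , refl
avoiding-sound (x ∷ u) (suc n) w∈
  with ∈-++⁻ (mapᴸ (x ∷_) (avoiding u n)) w∈
... | inj₁ p with w , w∈′ , refl ← ∈-map⁻ (x ∷_) p
               with avoid , len ← avoiding-sound u n w∈′ =
  avoids-match avoid , cong suc len
... | inj₂ p with w , w∈′ , refl ← ∈-map⁻ (not x ∷_) p
               with avoid , len ← avoiding-sound (x ∷ u) n w∈′ =
  avoids-fresh (not≢ x) avoid , cong suc len

unique-branch : ∀ {x y : Bool} {xs ys : List (List Bool)} → x ≢ y →
                Unique xs → Unique ys → Unique (mapᴸ (x ∷_) xs ++ᴸ mapᴸ (y ∷_) ys)
unique-branch x≢y uxs uys =
  Unique.++⁺ (Unique.map⁺ ∷-injectiveʳ uxs) (Unique.map⁺ ∷-injectiveʳ uys) disj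
  where
  disj : ∀ {v} → ¬ (v ∈ᴸ mapᴸ (_ ∷_) _ × v ∈ᴸ mapᴸ (_ ∷_) _)
  disj (p , q) with _ , _ , refl ← ∈-map⁻ _ p with _ , _ , eq ← ∈-map⁻ _ q =
    x≢y (∷-injectiveˡ eq)

avoiding-unique : ∀ u n → Unique (avoiding u n)
avoiding-unique []      n       = []
avoiding-unique (x ∷ u) zero    = [] ∷ []
avoiding-unique (x ∷ u) (suc n) =
  unique-branch (not≢ x ∘ sym) (avoiding-unique u n) (avoiding-unique (x ∷ u) n)

-- The number of subsets of size less than d of a set of size n.
small : ℕ → ℕ → ℕ
small n       zero    = 0
small zero    (suc d) = 1
small (suc n) (suc d) = small n d + small n (suc d)

length-branch : ∀ (x y : Bool) (xs ys : List (List Bool)) →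
                length (mapᴸ (x ∷_) xs ++ᴸ mapᴸ (y ∷_) ys) ≡ length xs + length ys
length-branch x y xs ys =
  trans (length-++ (mapᴸ (x ∷_) xs)) (cong₂ _+_ (length-map _ xs) (length-map _ ys))

avoiding-length : ∀ u n → length (avoiding u n) ≡ small n (length u)
avoiding-length []      n       = refl
avoiding-length (x ∷ u) zero    = refl
avoiding-length (x ∷ u) (suc n) =
  trans (length-branch x (not x) (avoiding u n) (avoiding (x ∷ u) n))
        (cong₂ _+_ (avoiding-length u n) (avoiding-length (x ∷ u) n))

-- Completing a partial word: an open position gets the letter that makes no
-- progress towards an occurrence of u.

guess : List Bool → Maybe Bool → Bool
guess u       (just y) = y
guess []      nothing  = false
guess (x ∷ u) nothing  = not x

advance : List Bool → Maybe Bool → List Bool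
advance u       nothing  = u
advance []      (just y) = []
advance (x ∷ u) (just y) = if does (y ≟ᵇ x) then u else x ∷ u

complete : List Bool → (ℕ → Maybe Bool) → ℕ → Bool
complete u g zero    = guess u (g zero)
complete u g (suc i) = complete (advance u (g zero)) (g ∘ suc) i

complete-just : ∀ u g i {y} → g i ≡ just y → complete u g i ≡ y
complete-just u g zero    eq rewrite eq = refl
complete-just u g (suc i) eq = complete-just (advance u (g zero)) (g ∘ suc) i eq

-- The part of u that the greedy search has still to find changes only at prescribed letters, since
-- every open position receives the letter that the search ignores. The completed word therefore
-- gets no further through u than the prescribed letters alone.
complete-avoids : ∀ u g m → Avoids u (catMaybes (applyUpTo g m)) →
                  Avoids u (applyUpTo (complete u g) m)
complete-avoids []      g m       avoid = contradiction (minimum _) avoid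
complete-avoids (x ∷ u) g zero    avoid = λ ()
complete-avoids (x ∷ u) g (suc m) avoid with g zero
... | nothing =
  avoids-fresh (not≢ x) (complete-avoids (x ∷ u) (g ∘ suc) m avoid)
... | just y with y ≟ᵇ x
...   | yes refl = avoids-match (complete-avoids u (g ∘ suc) m (avoids-match⁻ avoid))
...   | no  y≢x  = avoids-fresh y≢x (complete-avoids (x ∷ u) (g ∘ suc) m (avoids-fresh⁻ avoid))

-- Words on a set of positions, given by its characteristic function

mask : {A : Set} → (ℕ → Bool) → (ℕ → A) → ℕ → Maybe A
mask μ χ i = if μ i then just (χ i) else nothing

select : {A : Set} → (ℕ → Bool) → (ℕ → A) → ℕ → List A
select μ χ m = catMaybes (applyUpTo (mask μ χ) m)

spread : (ℕ → Bool) → List Bool → ℕ → Bool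
spread μ []      i = false
spread μ (y ∷ w) i with μ zero
spread μ (y ∷ w) zero    | true  = y
spread μ (y ∷ w) (suc i) | true  = spread (μ ∘ suc) w i
spread μ (y ∷ w) zero    | false = false
spread μ (y ∷ w) (suc i) | false = spread (μ ∘ suc) (y ∷ w) i

select-⊑ : ∀ {A : Set} μ (χ : ℕ → A) m → select μ χ m ⊑ applyUpTo χ m
select-⊑ μ χ zero    = []
select-⊑ μ χ (suc m) with μ zero
... | true  = refl ∷ select-⊑ (μ ∘ suc) (χ ∘ suc) m
... | false = χ zero ∷ʳ select-⊑ (μ ∘ suc) (χ ∘ suc) m

select-cong : ∀ {A : Set} μ {χ χ′ : ℕ → A} m →
              (∀ i → i < m → μ i ≡ true → χ i ≡ χ′ i) →
              select μ χ m ≡ select μ χ′ m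
select-cong μ zero    eq = refl
select-cong μ (suc m) eq with μ zero in μ₀
... | true  = cong₂ _∷_ (eq zero (s≤s z≤n) μ₀)
                (select-cong (μ ∘ suc) m λ i i<m → eq (suc i) (s≤s i<m))
... | false = select-cong (μ ∘ suc) m λ i i<m → eq (suc i) (s≤s i<m)

select-injective : ∀ {A : Set} μ {χ χ′ : ℕ → A} m →
                   select μ χ m ≡ select μ χ′ m →
                   ∀ i → i < m → μ i ≡ true → χ i ≡ χ′ i
select-injective μ (suc m) eq i i<m μᵢ with μ zero in μ₀
select-injective μ (suc m) eq zero    i<m μᵢ | true  = ∷-injectiveˡ eq
select-injective μ (suc m) eq (suc i) i<m μᵢ | true  =
  select-injective (μ ∘ suc) m (∷-injectiveʳ eq) i (s≤s⁻¹ i<m) μᵢ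
select-injective μ (suc m) eq zero    i<m μᵢ | false = contradiction (trans (sym μᵢ) μ₀) λ ()
select-injective μ (suc m) eq (suc i) i<m μᵢ | false =
  select-injective (μ ∘ suc) m eq i (s≤s⁻¹ i<m) μᵢ

select-length : ∀ {A B : Set} μ (χ : ℕ → A) (χ′ : ℕ → B) m →
                length (select μ χ m) ≡ length (select μ χ′ m)
select-length μ χ χ′ zero    = refl
select-length μ χ χ′ (suc m) with μ zero
... | true  = cong suc (select-length (μ ∘ suc) (χ ∘ suc) (χ′ ∘ suc) m)
... | false = select-length (μ ∘ suc) (χ ∘ suc) (χ′ ∘ suc) m

select-spread : ∀ {A : Set} μ (χ : ℕ → A) m w → length w ≡ length (select μ χ m) →
                select μ (spread μ w) m ≡ w
select-spread μ χ zero    []      len = refl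
select-spread μ χ (suc m) []      len with μ zero
... | false = select-spread (μ ∘ suc) (χ ∘ suc) m [] len
select-spread μ χ (suc m) (y ∷ w) len with μ zero
... | true  = cong (y ∷_) (select-spread (μ ∘ suc) (χ ∘ suc) m w (suc-injective len))
... | false = select-spread (μ ∘ suc) (χ ∘ suc) m (y ∷ w) len

∈-select⁺ : ∀ {A : Set} μ (χ : ℕ → A) m i → i < m → μ i ≡ true → χ i ∈ᴸ select μ χ m
∈-select⁺ μ χ (suc m) i i<m μᵢ with μ zero in μ₀
∈-select⁺ μ χ (suc m) zero    i<m μᵢ | true  = here refl
∈-select⁺ μ χ (suc m) (suc i) i<m μᵢ | true  =
  there (∈-select⁺ (μ ∘ suc) (χ ∘ suc) m i (s≤s⁻¹ i<m) μᵢ)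
∈-select⁺ μ χ (suc m) zero    i<m μᵢ | false = contradiction (trans (sym μᵢ) μ₀) λ ()
∈-select⁺ μ χ (suc m) (suc i) i<m μᵢ | false =
  ∈-select⁺ (μ ∘ suc) (χ ∘ suc) m i (s≤s⁻¹ i<m) μᵢ

∈-select⁻ : ∀ {A : Set} μ (χ : ℕ → A) m {x} → x ∈ᴸ select μ χ m →
            ∃ λ i → i < m × μ i ≡ true × x ≡ χ i
∈-select⁻ μ χ (suc m) x∈ with μ zero in μ₀
∈-select⁻ μ χ (suc m) (here eq)  | true = zero , s≤s z≤n , μ₀ , eq
∈-select⁻ μ χ (suc m) (there x∈) | true
  with i , i<m , μᵢ , eq ← ∈-select⁻ (μ ∘ suc) (χ ∘ suc) m x∈ = suc i , s≤s i<m , μᵢ , eq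
∈-select⁻ μ χ (suc m) x∈ | false
  with i , i<m , μᵢ , eq ← ∈-select⁻ (μ ∘ suc) (χ ∘ suc) m x∈ = suc i , s≤s i<m , μᵢ , eq

select-unique : ∀ {A : Set} μ (χ : ℕ → A) m → (∀ {i j} → χ i ≡ χ j → i ≡ j) →
                Unique (select μ χ m)
select-unique μ χ zero    inj = []
select-unique μ χ (suc m) inj with μ zero
... | false = select-unique (μ ∘ suc) (χ ∘ suc) m (suc-injective ∘ inj)
... | true  = Allᴸ.tabulate fresh ∷ select-unique (μ ∘ suc) (χ ∘ suc) m (suc-injective ∘ inj)
  where
  fresh : ∀ {x} → x ∈ᴸ select (μ ∘ suc) (χ ∘ suc) m → χ zero ≢ x
  fresh x∈ eq with _ , _ , _ , refl ← ∈-select⁻ (μ ∘ suc) (χ ∘ suc) m x∈ = 0≢1+n (inj eq)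

-- Counting with lists

unique-lookup-injective : ∀ {a} {A : Set a} {xs : List A} → Unique xs →
                          Injective _≡_ _≡_ (lookupᴸ xs)
unique-lookup-injective (x∉ ∷ u) {zero}  {zero}  eq = refl
unique-lookup-injective (x∉ ∷ u) {zero}  {suc j} eq =
  contradiction eq (Allᴸ.lookup x∉ (∈-lookup j))
unique-lookup-injective (x∉ ∷ u) {suc i} {zero}  eq =
  contradiction (sym eq) (Allᴸ.lookup x∉ (∈-lookup i))
unique-lookup-injective (x∉ ∷ u) {suc i} {suc j} eq =
  cong suc (unique-lookup-injective u eq)

index-injective : ∀ {a} {A : Set a} {xs : List A} {x y} (p : x ∈ᴸ xs) (q : y ∈ᴸ xs) →
                  index p ≡ index q → x ≡ y
index-injective {xs = xs} p q eq =
  trans (lookup-index p) (trans (cong (lookupᴸ xs) eq) (sym (lookup-index q)))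

^-distribʳ-* : ∀ d m n → (m * n) ^ d ≡ m ^ d * n ^ d
^-distribʳ-* zero    m n = refl
^-distribʳ-* (suc d) m n rewrite ^-distribʳ-* d m n =
  solve 4 (λ m n p q → m :* n :* (p :* q) := m :* p :* (n :* q)) refl m n (m ^ d) (n ^ d)
  where open +-*-Solver

-- Words with long blocks, and the number of words without them

target : ℕ → ℕ → Bool → List Bool → List Bool
target n k a []       = replicate k a
target n k a (b ∷ as) = replicate k a ++ᴸ not a ∷ target n n b as

target-suc : ∀ n k a as → target n (suc k) a as ≡ a ∷ target n k a as
target-suc n k a []       = refl
target-suc n k a (b ∷ as) = refl

-- A greedy embedding: letters a go into the current block, the first other letter goes to the
-- separator `not a` and so matches one more letter of `mapᴸ not (a ∷ as)`. The induction needs k,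
-- the room left in the current block; a new block has the full length n, which is enough for the
-- rest of x.
⊑-target : ∀ n k a as x → length x ≤ k → k ≤ n →
           Avoids (mapᴸ not (a ∷ as)) x → x ⊑ target n k a as
⊑-target n k a as []      x≤k k≤n avoid = minimum _
⊑-target n (suc k) a as (y ∷ x) x≤k k≤n avoid with y ≟ᵇ a
... | yes refl rewrite target-suc n k a as =
  refl ∷ ⊑-target n k a as x (s≤s⁻¹ x≤k) (≤-trans (n≤1+n k) k≤n) (avoids-fresh⁻ avoid)
... | no y≢a with refl ← not-≢ y≢a with as
-- The last block has no separator after it: a letter other than a would here complete the forbidden
-- subword.
...   | []     = contradiction (minimum x) (avoids-match⁻ avoid)
...   | b ∷ bs = ⊑-++ˡ (replicate (suc k) a)
  (refl ∷ ⊑-target n n b bs x (≤-trans (n≤1+n _) (≤-trans x≤k k≤n)) ≤-refl (avoids-match⁻ avoid))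

-- The words of length N that contain no target n n a as with length as ≡ e,
-- listed by reading them from the left: counting n i j e N still waits for
-- i letters false or j letters true, and waiting n a e N, which has seen
-- n letters a, for the next letter other than a.
counting  : (n i j e N : ℕ) → List (List Bool)
waiting : (n : ℕ) (a : Bool) (e N : ℕ) → List (List Bool)

counting n zero    j       e N       = waiting n false e N
counting n (suc i) zero    e N       = waiting n true e N
counting n (suc i) (suc j) e zero    = [] ∷ []
counting n (suc i) (suc j) e (suc N) =
  mapᴸ (false ∷_) (counting n i (suc j) e N) ++ᴸ mapᴸ (true ∷_) (counting n (suc i) j e N)

waiting n a zero    N       = []
waiting n a (suc e) zero    = [] ∷ []
waiting n a (suc e) (suc N) =
  mapᴸ (a ∷_) (waiting n a (suc e) N) ++ᴸ mapᴸ (not a ∷_) (counting n n n e N)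

counting-unique  : ∀ n i j e N → Unique (counting n i j e N)
waiting-unique : ∀ n a e N → Unique (waiting n a e N)

counting-unique n zero    j       e N       = waiting-unique n false e N
counting-unique n (suc i) zero    e N       = waiting-unique n true e N
counting-unique n (suc i) (suc j) e zero    = Allᴸ.[] ∷ []
counting-unique n (suc i) (suc j) e (suc N) =
  unique-branch (λ ()) (counting-unique n i (suc j) e N) (counting-unique n (suc i) j e N)

waiting-unique n a zero    N       = []
waiting-unique n a (suc e) zero    = Allᴸ.[] ∷ []
waiting-unique n a (suc e) (suc N) =
  unique-branch (not≢ a ∘ sym) (waiting-unique n a (suc e) N) (counting-unique n n n e N)

-- The letter a is the one whose counter runs out first while w is read, and `if a then j else i` is
-- the number of its occurrences still missing at the start.
counting-cover : ∀ n i j e w → w ∈ᴸ counting n i j e (length w) ⊎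
  ∃₂ λ a as → length as ≡ e × target n (if a then j else i) a as ⊑ w
waiting-cover : ∀ n a e w → w ∈ᴸ waiting n a e (length w) ⊎
  ∃ λ as → length as ≡ e × target n 0 a as ⊑ w

counting-cover n zero j e w with waiting-cover n false e w
... | inj₁ w∈              = inj₁ w∈
... | inj₂ (as , len , ⊑w) = inj₂ (false , as , len , ⊑w)
counting-cover n (suc i) zero e w with waiting-cover n true e w
... | inj₁ w∈              = inj₁ w∈
... | inj₂ (as , len , ⊑w) = inj₂ (true , as , len , ⊑w)
counting-cover n (suc i) (suc j) e []          = inj₁ (here refl)
counting-cover n (suc i) (suc j) e (false ∷ w) with counting-cover n i (suc j) e w
... | inj₁ w∈                      = inj₁ (∈-++⁺ˡ (∈-map⁺ (false ∷_) w∈))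
... | inj₂ (true  , as , len , ⊑w) = inj₂ (true , as , len , false ∷ʳ ⊑w)
... | inj₂ (false , as , len , ⊑w) =
  inj₂ (false , as , len , subst (_⊑ _) (sym (target-suc n i false as)) (refl ∷ ⊑w))
counting-cover n (suc i) (suc j) e (true ∷ w) with counting-cover n (suc i) j e w
... | inj₁ w∈                      =
  inj₁ (∈-++⁺ʳ (mapᴸ (false ∷_) (counting n i (suc j) e (length w))) (∈-map⁺ (true ∷_) w∈))
... | inj₂ (false , as , len , ⊑w) = inj₂ (false , as , len , true ∷ʳ ⊑w)
... | inj₂ (true  , as , len , ⊑w) =
  inj₂ (true , as , len , subst (_⊑ _) (sym (target-suc n j true as)) (refl ∷ ⊑w))

-- With n letters a already read and no further block required, the rest of the target is the empty
-- word.
waiting-cover n a zero    w       = inj₂ ([] , refl , minimum w)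
waiting-cover n a (suc e) []      = inj₁ (here refl)
waiting-cover n a (suc e) (y ∷ w) with y ≟ᵇ a
... | yes refl with waiting-cover n a (suc e) w
...   | inj₁ w∈              = inj₁ (∈-++⁺ˡ (∈-map⁺ (a ∷_) w∈))
...   | inj₂ (as , len , ⊑w) = inj₂ (as , len , a ∷ʳ ⊑w)
waiting-cover n a (suc e) (y ∷ w) | no y≢a with refl ← not-≢ y≢a
  with counting-cover n n n e w
... | inj₁ w∈                      =
  inj₁ (∈-++⁺ʳ (mapᴸ (a ∷_) (waiting n a (suc e) (length w))) (∈-map⁺ (not a ∷_) w∈))
... | inj₂ (false , as , len , ⊑w) = inj₂ (false ∷ as , cong suc len , refl ∷ ⊑w)
... | inj₂ (true  , as , len , ⊑w) = inj₂ (true ∷ as , cong suc len , refl ∷ ⊑w)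

module _ (n : ℕ) where

  private
    -- At e = 0 the lists consist of the words with fewer than i letters false and fewer than j
    -- letters true. Such words are shorter than i + j, so their number over all lengths below N has
    -- a bound that is independent of N.
    total : ℕ → ℕ → ℕ → ℕ
    total i j zero    = 0
    total i j (suc N) = total i j N + length (counting n i j 0 N)

    counting-branch : ∀ i j e N →
      length (counting n (suc i) (suc j) e (suc N)) ≡
      length (counting n i (suc j) e N) + length (counting n (suc i) j e N)
    counting-branch i j e N = length-branch false true (counting n i (suc j) e N) _

    waiting-branch : ∀ a e N →
      length (waiting n a (suc e) (suc N)) ≡
      length (waiting n a (suc e) N) + length (counting n n n e N)
    waiting-branch a e N = length-branch a (not a) (waiting n a (suc e) N) _

    total-suc : ∀ i j N → total (suc i) (suc j) (suc N) ≡
                suc (total i (suc j) N + total (suc i) j N)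
    total-suc i j zero    = refl
    total-suc i j (suc N) rewrite total-suc i j N | counting-branch i j 0 N =
      solve 4 (λ p q x y → con 1 :+ (p :+ q) :+ (x :+ y) :=
                           con 1 :+ (p :+ x :+ (q :+ y))) refl
        (total i (suc j) N) (total (suc i) j N)
        (length (counting n i (suc j) 0 N)) (length (counting n (suc i) j 0 N))
      where open +-*-Solver

    total-zeroˡ : ∀ j N → total zero j N ≡ 0
    total-zeroˡ j zero    = refl
    total-zeroˡ j (suc N) rewrite total-zeroˡ j N = refl

    total-zeroʳ : ∀ i N → total i zero N ≡ 0
    total-zeroʳ i       zero    = refl
    total-zeroʳ zero    (suc N) rewrite total-zeroʳ zero N = refl
    total-zeroʳ (suc i) (suc N) rewrite total-zeroʳ (suc i) N = refl

    double : ∀ i j → 2 ^ (suc i + suc j) ≡ 2 ^ (i + suc j) + 2 ^ (suc i + j)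
    double i j rewrite +-suc i j | +-identityʳ (2 ^ (i + j) + (2 ^ (i + j) + 0)) = refl

    total-bound : ∀ i j N → total i j N < 2 ^ (i + j)
    total-bound zero    j       N rewrite total-zeroˡ j N = m^n>0 2 j
    total-bound (suc i) zero    N rewrite total-zeroʳ (suc i) N = m^n>0 2 (suc i + 0)
    total-bound (suc i) (suc j) zero    = m^n>0 2 (suc i + suc j)
    total-bound (suc i) (suc j) (suc N) = begin
      suc (total (suc i) (suc j) (suc N))                   ≡⟨ cong suc (total-suc i j N) ⟩
      suc (suc (total i (suc j) N + total (suc i) j N))     ≡⟨ cong suc (+-suc _ _) ⟨
      suc (total i (suc j) N) + suc (total (suc i) j N)
        ≤⟨ +-mono-≤ (total-bound i (suc j) N) (total-bound (suc i) j N) ⟩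
      2 ^ (i + suc j) + 2 ^ (suc i + j)                     ≡⟨ double i j ⟨
      2 ^ (suc i + suc j)                                   ∎
      where open ≤-Reasoning

    -- Summing over the length of the run of a gives a sum over the lengths of the remaining words,
    -- and at e = 0 that sum stays bounded. This is where one power of N is saved.
    waiting-1 : ∀ a N → length (waiting n a 1 N) ≡ suc (total n n N)
    waiting-1 a zero    = refl
    waiting-1 a (suc N) = trans (waiting-branch a 0 N)
      (cong (_+ length (counting n n n 0 N)) (waiting-1 a N))

  growth : ℕ → ℕ
  growth zero    = 2 ^ (n + n)
  growth (suc d) = 1 + 2 ^ (n + n) * growth d

  private
    growth-nonZero : ∀ d → 1 ≤ growth d
    growth-nonZero zero    = m^n>0 2 (n + n)
    growth-nonZero (suc d) = s≤s z≤n

    -- The binary tree of first letters has depth at most i + j before every branch has become a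
    -- `waiting` list, hence the factor 2 ^ (i + j). Monotonicity of B accounts for the letters
    -- already read.
    counting-from-waiting : ∀ e (B : ℕ → ℕ) → (∀ N → 1 ≤ B N) → (∀ N → B N ≤ B (suc N)) →
      (∀ a N → length (waiting n a e N) ≤ B N) →
      ∀ i j N → length (counting n i j e N) ≤ 2 ^ (i + j) * B N
    counting-from-waiting e B 1≤B mono bound = go
      where
      open ≤-Reasoning
      weaken : ∀ {x} k N → x ≤ B N → x ≤ 2 ^ k * B N
      weaken k N x≤ = ≤-trans x≤ (m≤n*m (B N) (2 ^ k) {{m^n≢0 2 k}})
      go : ∀ i j N → length (counting n i j e N) ≤ 2 ^ (i + j) * B N
      go zero    j       N       = weaken j N (bound false N)
      go (suc i) zero    N       = weaken (suc i + 0) N (bound true N)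
      go (suc i) (suc j) zero    = weaken (suc i + suc j) 0 (1≤B 0)
      go (suc i) (suc j) (suc N) = begin
        length (counting n (suc i) (suc j) e (suc N)) ≡⟨ counting-branch i j e N ⟩
        length (counting n i (suc j) e N) + length (counting n (suc i) j e N)
          ≤⟨ +-mono-≤ (go i (suc j) N) (go (suc i) j N) ⟩
        2 ^ (i + suc j) * B N + 2 ^ (suc i + j) * B N
          ≡⟨ *-distribʳ-+ (B N) (2 ^ (i + suc j)) _ ⟨
        (2 ^ (i + suc j) + 2 ^ (suc i + j)) * B N     ≡⟨ cong (_* B N) (double i j) ⟨
        2 ^ (suc i + suc j) * B N                     ≤⟨ *-monoʳ-≤ (2 ^ (suc i + suc j)) (mono N) ⟩
        2 ^ (suc i + suc j) * B (suc N)               ∎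

    power : ℕ → ℕ → ℕ
    power d N = growth d * suc N ^ d

    counting-power : ∀ d → (∀ a N → length (waiting n a (suc d) N) ≤ power d N) →
      ∀ i j N → length (counting n i j (suc d) N) ≤ 2 ^ (i + j) * power d N
    counting-power d = counting-from-waiting (suc d) (power d)
      (λ N → *-mono-≤ (growth-nonZero d) (m^n>0 (suc N) d))
      (λ N → *-monoʳ-≤ (growth d) (^-monoˡ-≤ d (n≤1+n (suc N))))

  -- The first letter other than a has at most N possible positions, and for each the rest of the
  -- word is bounded by the preceding case; so every step raises the degree by one. The base `suc N`
  -- keeps the bound positive at N = 0.
  waiting-bound : ∀ d a N → length (waiting n a (suc d) N) ≤ growth d * suc N ^ d
  waiting-bound zero    a N rewrite waiting-1 a N | *-identityʳ (2 ^ (n + n)) =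
    total-bound n n N
  waiting-bound (suc d) a N = begin
    length (waiting n a (suc (suc d)) N)        ≤⟨ linear N ≤-refl ⟩
    1 + N * X                                     ≤⟨ +-monoˡ-≤ (N * X) (m^n>0 (suc N) (suc d)) ⟩
    suc N ^ suc d + N * X                         ≤⟨ +-monoʳ-≤ (suc N ^ suc d) (*-monoˡ-≤ X (n≤1+n N)) ⟩
    suc N ^ suc d + suc N * X
      ≡⟨ solve 4 (λ P S G M → S :* P :+ S :* (M :* (G :* P)) :=
                              (con 1 :+ M :* G) :* (S :* P)) refl
         (suc N ^ d) (suc N) (growth d) (2 ^ (n + n)) ⟩
    growth (suc d) * suc N ^ suc d                ∎
    where
    open ≤-Reasoning
    open +-*-Solver
    X = 2 ^ (n + n) * (growth d * suc N ^ d)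
    linear : ∀ k → k ≤ N → length (waiting n a (suc (suc d)) k) ≤ 1 + k * X
    linear zero    k≤N = s≤s z≤n
    linear (suc k) k<N = begin
      length (waiting n a (suc (suc d)) (suc k)) ≡⟨ waiting-branch a (suc d) k ⟩
      length (waiting n a (suc (suc d)) k) + length (counting n n n (suc d) k)
        ≤⟨ +-mono-≤ (linear k (≤-trans (n≤1+n k) k<N))
             (≤-trans (counting-power d (waiting-bound d) n n k)
               (*-monoʳ-≤ (2 ^ (n + n)) (*-monoʳ-≤ (growth d)
                 (^-monoˡ-≤ d (s≤s (≤-trans (n≤1+n k) k<N)))))) ⟩
      1 + k * X + X                                ≡⟨ cong suc (+-comm (k * X) X) ⟩
      1 + suc k * X                                ∎

  counting-bound : ∀ d N .{{_ : NonZero N}} →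
    length (counting n n n (suc d) N) ≤ 2 ^ (n + n) * (growth d * 2 ^ d) * N ^ d
  counting-bound d N@(suc N-1) = begin
    length (counting n n n (suc d) N)          ≤⟨ counting-power d (waiting-bound d) n n N ⟩
    2 ^ (n + n) * (growth d * suc N ^ d)
      ≤⟨ *-monoʳ-≤ (2 ^ (n + n)) (*-monoʳ-≤ (growth d) (^-monoˡ-≤ d N+1≤2N)) ⟩
    2 ^ (n + n) * (growth d * (2 * N) ^ d)
      ≡⟨ cong (λ x → 2 ^ (n + n) * (growth d * x)) (^-distribʳ-* d 2 N) ⟩
    2 ^ (n + n) * (growth d * (2 ^ d * N ^ d))
      ≡⟨ solve 4 (λ M G E P → M :* (G :* (E :* P)) := M :* (G :* E) :* P) refl
         (2 ^ (n + n)) (growth d) (2 ^ d) (N ^ d) ⟩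
    2 ^ (n + n) * (growth d * 2 ^ d) * N ^ d   ∎
    where
    open ≤-Reasoning
    open +-*-Solver
    N+1≤2N : suc N ≤ 2 * N
    N+1≤2N = s≤s (≤-trans (≤-reflexive (+-comm 1 N-1)) (+-monoʳ-≤ N-1 (s≤s z≤n)))

-- Cardinalities from lists, and positions of letters

hasCard-list : ∀ {a b c w} (S : Setoid a b) (A : Pred (Setoid.Carrier S) c) {W : Set w}
  (ws : List W) → Unique ws → (f : W → Setoid.Carrier S) →
  (∀ {w} → w ∈ᴸ ws → f w ∈ A) →
  (∀ {v w} → v ∈ᴸ ws → w ∈ᴸ ws → Setoid._≈_ S (f v) (f w) → v ≡ w) →
  (∀ {x} → x ∈ A → ∃ λ w → w ∈ᴸ ws × Setoid._≈_ S (f w) x) →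
  HasCard S A (Fin (length ws))
hasCard-list S A ws unique f f∈A f-inj f-surj = record
  { to        = λ i → f (lookupᴸ ws i) , f∈A (∈-lookup i)
  ; cong      = λ { refl → Setoid.refl S }
  ; bijective =
      (λ {i} {j} eq → unique-lookup-injective unique (f-inj (∈-lookup i) (∈-lookup j) eq)) ,
      λ { (x , x∈A) → let w , w∈ , eq = f-surj x∈A in index w∈ ,
          λ { refl → subst (λ v → Setoid._≈_ S (f v) x) (lookup-index w∈) eq } }
  }

letter : List Bool → ℕ → Bool
letter []      i       = false
letter (y ∷ w) zero    = y
letter (y ∷ w) (suc i) = letter w i

letter-tabulate : ∀ {N} (χ : Fin N → Bool) i → letter (tabulateᴸ χ) (toℕ i) ≡ χ i
letter-tabulate χ zero    = refl
letter-tabulate χ (suc i) = letter-tabulate (χ ∘ suc) i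

letter-injective : ∀ {N} v w → length v ≡ N → length w ≡ N →
                   (∀ (i : Fin N) → letter v (toℕ i) ≡ letter w (toℕ i)) → v ≡ w
letter-injective []      []      refl _  eq = refl
letter-injective (x ∷ v) (y ∷ w) refl |w| eq =
  cong₂ _∷_ (eq zero) (letter-injective v w refl (suc-injective |w|) (eq ∘ suc))

sublist-positions : ∀ {n N} (x : Vec Bool n) (χ : Fin N → Bool) → toList x ⊑ tabulateᴸ χ →
  ∃ λ (i : Fin n → Fin N) → i Preserves Fin._<_ ⟶ Fin._<_ × (∀ t → lookup x t ≡ χ (i t))
sublist-positions               []      χ _          = (λ ()) , (λ { {()} }) , λ ()
sublist-positions {N = suc N} (y ∷ x) χ (_ ∷ʳ sub)
  with i , mono , eq ← sublist-positions (y ∷ x) (χ ∘ suc) sub = suc ∘ i , s≤s ∘ mono , eq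
sublist-positions {N = suc N} (y ∷ x) χ (y≡ ∷ sub)
  with i , mono , eq ← sublist-positions x (χ ∘ suc) sub =
  (λ { zero → zero ; (suc t) → suc (i t) }) ,
  (λ { {zero} {suc t} _ → s≤s z≤n ; {suc s} {suc t} s<t → s≤s (mono (s≤s⁻¹ s<t)) }) ,
  (λ { zero → y≡ ; (suc t) → eq t })

target-length : ∀ n k a as → k ≤ length (target n k a as)
target-length n k a []       = ≤-reflexive (sym (length-replicate k))
target-length n k a (b ∷ as) = ≤-trans
  (≤-trans (≤-reflexive (sym (length-replicate k))) (m≤m+n (length (replicate k a)) _))
  (≤-reflexive (sym (length-++ (replicate k a))))

counting-length  : ∀ n i j e N {w} → w ∈ᴸ counting n i j e N → length w ≡ N
waiting-length : ∀ n a e N {w} → w ∈ᴸ waiting n a e N → length w ≡ N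

counting-length n zero    j       e N       w∈          = waiting-length n false e N w∈
counting-length n (suc i) zero    e N       w∈          = waiting-length n true e N w∈
counting-length n (suc i) (suc j) e zero    (here refl) = refl
counting-length n (suc i) (suc j) e (suc N) w∈
  with ∈-++⁻ (mapᴸ (false ∷_) (counting n i (suc j) e N)) w∈
... | inj₁ p with v , v∈ , refl ← ∈-map⁻ (false ∷_) p = cong suc (counting-length n i (suc j) e N v∈)
... | inj₂ p with v , v∈ , refl ← ∈-map⁻ (true ∷_) p  = cong suc (counting-length n (suc i) j e N v∈)

waiting-length n a (suc e) zero    (here refl) = refl
waiting-length n a (suc e) (suc N) w∈
  with ∈-++⁻ (mapᴸ (a ∷_) (waiting n a (suc e) N)) w∈
... | inj₁ p with v , v∈ , refl ← ∈-map⁻ (a ∷_) p     = cong suc (waiting-length n a (suc e) N v∈)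
... | inj₂ p with v , v∈ , refl ← ∈-map⁻ (not a ∷_) p = cong suc (counting-length n n n e N v∈)

applyUpTo-⊑ : ∀ {a} {A : Set a} (f : ℕ → A) {m n} → m ≤ n → applyUpTo f m ⊑ applyUpTo f n
applyUpTo-⊑ f z≤n       = minimum _
applyUpTo-⊑ f (s≤s m≤n) = refl ∷ applyUpTo-⊑ (f ∘ suc) m≤n

bounded : ∀ {n} (f : Fin n → ℕ) → ∃ λ m → ∀ t → f t < m
bounded {zero}  f = 0 , λ ()
bounded {suc n} f with m , f< ← bounded (f ∘ suc) = suc (f zero) ⊔ m , λ where
  zero    → m≤m⊔n (suc (f zero)) m
  (suc t) → ≤-trans (f< t) (m≤n⊔m (suc (f zero)) m)

prefix : ∀ {a} {A : Set a} → (ℕ → A) → ∀ n → Vec A n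
prefix f zero    = []
prefix f (suc n) = f n ∷ prefix f n

toList-prefix : ∀ {a} {A : Set a} (f : ℕ → A) n → toList (prefix f n) ≡ reverse (applyUpTo f n)
toList-prefix f n = trans (go n) (sym (reverse-applyUpTo f n))
  where
  go : ∀ n → toList (prefix f n) ≡ applyDownFrom f n
  go zero    = refl
  go (suc n) = cong (f n ∷_) (go n)

words : ∀ n → List (Vec Bool n)
words zero    = [] ∷ []
words (suc n) = mapᴸ (true ∷_) (words n) ++ᴸ mapᴸ (false ∷_) (words n)

∈-words : ∀ {n} (w : Vec Bool n) → w ∈ᴸ words n
∈-words []          = here refl
∈-words (true ∷ w)  = ∈-++⁺ˡ (∈-map⁺ (true ∷_) (∈-words w))
∈-words (false ∷ w) = ∈-++⁺ʳ (mapᴸ (true ∷_) (words _)) (∈-map⁺ (false ∷_) (∈-words w))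

mark : Bool → ℕ → ℕ → Maybe Bool
mark x zero    zero    = just x
mark x zero    (suc i) = nothing
mark x (suc j) zero    = nothing
mark x (suc j) (suc i) = mark x j i

mark-at : ∀ x j → mark x j j ≡ just x
mark-at x zero    = refl
mark-at x (suc j) = mark-at x j

mark-length : ∀ x j m → length (catMaybes (applyUpTo (mark x j) m)) ≤ 1
mark-length x j       zero    = z≤n
mark-length x zero    (suc m) = s≤s (≤-reflexive (none m))
  where
  none : ∀ m → length (catMaybes (applyUpTo (λ i → mark x zero (suc i)) m)) ≡ 0
  none zero    = refl
  none (suc m) = none m
mark-length x (suc j) (suc m) = mark-length x j m

-- The completion is constantly `not x` before the marked position. With y = x the marked position
-- thus carries a letter that differs from all earlier ones, which separates members of a sequence.
complete-mark : ∀ x u y {i j} → i < j → complete (x ∷ u) (mark y j) i ≡ not x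
complete-mark x u y {zero}  (s≤s _)         = refl
complete-mark x u y {suc i} (s≤s i<j@(s≤s _)) = complete-mark x u y i<j

-- There are only finitely many words of length e. Splitting on the first letter takes the larger of
-- two bounds, and antitonicity lets the failure of R persist for larger n.
uniform-bound : ∀ {a} (R : List Bool → ℕ → Set a) → (∀ {u m n} → m ≤ n → R u n → R u m) → ∀ e →
  (∀ u → length u ≡ e → ∃ λ n → ¬ R u n) → ∃ λ n → ∀ u → length u ≡ e → ¬ R u n
uniform-bound R antitone zero    bound with n , ¬r ← bound [] refl = n , λ { [] _ → ¬r }
uniform-bound R antitone (suc e) bound
  with n₁ , ¬r₁ ← uniform-bound (R ∘ (true ∷_)) antitone e (λ u → bound (true ∷ u) ∘ cong suc)
  with n₂ , ¬r₂ ← uniform-bound (R ∘ (false ∷_)) antitone e (λ u → bound (false ∷ u) ∘ cong suc) =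
  n₁ ⊔ n₂ , λ where
    (true ∷ u)  ∣u∣ r → ¬r₁ u (suc-injective ∣u∣) (antitone (m≤m⊔n n₁ n₂) r)
    (false ∷ u) ∣u∣ r → ¬r₂ u (suc-injective ∣u∣) (antitone (m≤n⊔m n₁ n₂) r)

-- Sums of binomial coefficients

sum-pascal : ∀ n d (f : ℕ → ℕ) → (∀ i → f i ≡ n C i + n C suc i) →
             sum (applyUpTo f d) ≡ sum (applyUpTo (n C_) d) + sum (applyUpTo (λ i → n C suc i) d)
sum-pascal n d f eq = go d f (n C_) (λ i → n C suc i) eq
  where
  go : ∀ d (f g h : ℕ → ℕ) → (∀ i → f i ≡ g i + h i) →
       sum (applyUpTo f d) ≡ sum (applyUpTo g d) + sum (applyUpTo h d)
  go zero    f g h eq = refl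
  go (suc d) f g h eq rewrite eq 0 | go d (f ∘ suc) (g ∘ suc) (h ∘ suc) (eq ∘ suc) =
    solve 4 (λ a b c d → a :+ b :+ (c :+ d) := a :+ c :+ (b :+ d)) refl
      (g 0) (h 0) (sum (applyUpTo (g ∘ suc) d)) (sum (applyUpTo (h ∘ suc) d))
    where open +-*-Solver

sum-C : ∀ n d → sum (applyUpTo (n C_) d) ≡ small n d
sum-C n       zero    = refl
sum-C zero    (suc d) = cong suc (zeros d (λ i → zero C suc i) λ i → k>n⇒nCk≡0 {0} {suc i} (s≤s z≤n))
  where
  zeros : ∀ d (f : ℕ → ℕ) → (∀ i → f i ≡ 0) → sum (applyUpTo f d) ≡ 0
  zeros zero    f eq = refl
  zeros (suc d) f eq rewrite eq 0 = zeros d (f ∘ suc) (eq ∘ suc)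
sum-C (suc n) (suc d) = begin
  1 + sum (applyUpTo (λ i → suc n C suc i) d)
    ≡⟨ cong suc (sum-pascal n d _ λ i → sym (nCk+nC[k+1]≡[n+1]C[k+1] n i)) ⟩
  1 + (sum (applyUpTo (n C_) d) + sum (applyUpTo (λ i → n C suc i) d))
    ≡⟨ +-suc _ _ ⟨
  sum (applyUpTo (n C_) d) + sum (applyUpTo (n C_) (suc d))
    ≡⟨ cong₂ _+_ (sum-C n d) (sum-C n (suc d)) ⟩
  small n d + small n (suc d) ∎
  where open ≡-Reasoning

small-all : ∀ n d → n ≤ d → small n (suc d) ≡ 2 ^ n
small-all zero    d       n≤d       = refl
small-all (suc n) (suc d) (s≤s n≤d) = cong₂ _+_ (small-all n d n≤d)
  (trans (small-all n (suc d) (m≤n⇒m≤1+n n≤d)) (sym (+-identityʳ (2 ^ n))))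

choose≤-small : ∀ n d → n choose≤ d ≡ small n (suc d)
choose≤-small n d with d <ᵇ n in eq
... | true  = trans (cong sum (map-upTo (n C_) (suc d))) (sum-C n (suc d))
... | false = sym (small-all n d (≮⇒≥ λ d<n → subst T eq (<⇒<ᵇ d<n)))

small-mono : ∀ n d → small n d ≤ small (suc n) d
small-mono n zero    = z≤n
small-mono n (suc d) = m≤n+m (small n (suc d)) (small n d)

-- Each of the m steps of Pascal's rule that lead from n to m + n adds at least `small n d`.
small-grows : ∀ m n d → m * small n d ≤ small (m + n) (suc d)
small-grows zero    n d = z≤n
small-grows (suc m) n d = +-mono-≤ (mono m) (small-grows m n d)
  where
  mono : ∀ m → small n d ≤ small (m + n) d
  mono zero    = ≤-refl
  mono (suc m) = ≤-trans (mono m) (small-mono (m + n) d)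

-- Every step in d doubles the size of the set: half of it supplies the new factor, which is at
-- least t, the other half carries the induction hypothesis. Hence the size 2 ^ d * t.
small-lower : ∀ d t → t ^ d ≤ small (2 ^ d * t) (suc d)
small-lower zero    t = ≤-reflexive (sym (ones (1 * t)))
  where
  ones : ∀ n → small n 1 ≡ 1
  ones zero    = refl
  ones (suc n) = ones n
small-lower (suc d) t = begin
  t * t ^ d                                        ≤⟨ *-mono-≤ t≤2ᵈt (small-lower d t) ⟩
  2 ^ d * t * small (2 ^ d * t) (suc d)            ≤⟨ small-grows (2 ^ d * t) (2 ^ d * t) (suc d) ⟩
  small (2 ^ d * t + 2 ^ d * t) (suc (suc d))
    ≡⟨ cong (λ n → small n (suc (suc d)))
         (solve 2 (λ e t → e :* t :+ e :* t := (con 2 :* e) :* t) refl (2 ^ d) t) ⟩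
  small (2 ^ suc d * t) (suc (suc d))              ∎
  where
  open ≤-Reasoning
  open +-*-Solver
  t≤2ᵈt : t ≤ 2 ^ d * t
  t≤2ᵈt = m≤n*m t (2 ^ d) {{m^n≢0 2 d}}

-- Real exponents

fromℕ-normal : ∀ d → + d ℚ./ 1 ≡ mkℚ (+ d) 0 (coprime-sym (1-coprimeTo d))
fromℕ-normal d = ℚ.normalize-coprime (coprime-sym (1-coprimeTo d))

<^ℚ-fromℕ : ∀ {s K N} d → s < K * N ^ d → s < K · N ^ℚ (+ d ℚ./ 1)
<^ℚ-fromℕ {s} {K} {N} d s< rewrite fromℕ-normal d | *-identityʳ s | *-identityʳ K = s<

^-cancelˡ-< : ∀ m {x y} → x ^ m < y ^ m → x < y
^-cancelˡ-< m xᵐ<yᵐ = ≰⇒> λ y≤x → <⇒≱ xᵐ<yᵐ (^-monoˡ-≤ m y≤x)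

^-swap : ∀ x m b → (x ^ m) ^ b ≡ (x ^ b) ^ m
^-swap x m b = trans (^-*-assoc x m b) (trans (cong (x ^_) (*-comm m b)) (sym (^-*-assoc x b m)))

private
  -- This is q + 1/b ≤ d with the denominators cleared, b being the denominator of p. From p < d the
  -- integer numerator of p is at most b d - 1, and this gives the gap 1/b.
  exponents : ∀ {q p : ℚ} d → q ℚ.≤ p → p ℚ.< + d ℚ./ 1 →
              ↥ q ℤ.* ↧ p ℤ.+ ↧ q ℤ.≤ + (↧ₙ p * d * ↧ₙ q)
  exponents {q@record{}} {p@record{}} d q≤p p<d rewrite fromℕ-normal d = begin
    ↥ q ℤ.* ↧ p ℤ.+ ↧ q           ≤⟨ ℤ.+-monoˡ-≤ (↧ q) (ℚ.drop-*≤* q≤p) ⟩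
    ↥ p ℤ.* ↧ q ℤ.+ ↧ q
      ≡⟨ solve 2 (λ a b → a :* b :+ b := (con (+ 1) :+ a) :* b) refl (↥ p) (↧ q) ⟩
    ℤ.suc (↥ p) ℤ.* ↧ q
      ≤⟨ ℤ.*-monoʳ-≤-nonNeg (↧ q) (ℤ.i<j⇒suc[i]≤j
           (subst (ℤ._< + d ℤ.* ↧ p) (ℤ.*-identityʳ (↥ p)) (ℚ.drop-*<* p<d))) ⟩
    + d ℤ.* ↧ p ℤ.* ↧ q           ≡⟨ cong (ℤ._* ↧ q) (ℤ.*-comm (+ d) (↧ p)) ⟩
    ↧ p ℤ.* + d ℤ.* ↧ q           ≡⟨ cong (ℤ._* ↧ q) (ℤ.pos-* (↧ₙ p) d) ⟨
    + (↧ₙ p * d) ℤ.* ↧ q          ≡⟨ ℤ.pos-* (↧ₙ p * d) (↧ₙ q) ⟨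
    + (↧ₙ p * d * ↧ₙ q)           ∎
    where
    open ℤ.≤-Reasoning
    open ℤSolver.+-*-Solver

-- If q ≤ p < d and b is the denominator of p, then q ≤ d − 1/b.
<^ℚ⇒< : ∀ {s K N} .{{_ : NonZero N}} (q p : ℚ) d → q ℚ.≤ p → p ℚ.< + d ℚ./ 1 →
        s < K · N ^ℚ q → s ^ ↧ₙ p * N < K ^ ↧ₙ p * N ^ (↧ₙ p * d)
<^ℚ⇒< {s} {K} {N} q@(mkℚ (+ n) m-1 _) p@record{} d q≤p p<d s< =
  -- Both sides are raised to the power m, the denominator of q, so that only integer exponents of N
  -- occur.
  ^-cancelˡ-< m (begin-strict
    (s ^ b * N) ^ m               ≡⟨ ^-distribʳ-* m (s ^ b) N ⟩
    (s ^ b) ^ m * N ^ m           ≡⟨ cong (_* N ^ m) (^-swap s b m) ⟩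
    (s ^ m) ^ b * N ^ m           <⟨ *-monoˡ-< (N ^ m) {{m^n≢0 N m}} (^-monoˡ-< b s<) ⟩
    (K ^ m * N ^ n) ^ b * N ^ m   ≡⟨ cong (_* N ^ m) (^-distribʳ-* b (K ^ m) (N ^ n)) ⟩
    (K ^ m) ^ b * (N ^ n) ^ b * N ^ m
      ≡⟨ cong₂ (λ x y → x * y * N ^ m) (^-swap K m b) (^-*-assoc N n b) ⟩
    (K ^ b) ^ m * N ^ (n * b) * N ^ m   ≡⟨ *-assoc ((K ^ b) ^ m) _ _ ⟩
    (K ^ b) ^ m * (N ^ (n * b) * N ^ m) ≡⟨ cong ((K ^ b) ^ m *_) (^-distribˡ-+-* N (n * b) m) ⟨
    (K ^ b) ^ m * N ^ (n * b + m)
      ≤⟨ *-monoʳ-≤ ((K ^ b) ^ m) (^-monoʳ-≤ N (ℤ.drop‿+≤+ e)) ⟩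
    (K ^ b) ^ m * N ^ (b * d * m)       ≡⟨ cong ((K ^ b) ^ m *_) (^-*-assoc N (b * d) m) ⟨
    (K ^ b) ^ m * (N ^ (b * d)) ^ m     ≡⟨ ^-distribʳ-* m (K ^ b) (N ^ (b * d)) ⟨
    (K ^ b * N ^ (b * d)) ^ m           ∎)
  where
  open ≤-Reasoning
  b = ↧ₙ p
  m = suc m-1
  e : + (n * b + m) ℤ.≤ + (b * d * m)
  e = subst (ℤ._≤ + (b * d * m)) (trans (cong (ℤ._+ + m) (sym (ℤ.pos-* n b))) (sym (ℤ.pos-+ (n * b) m)))
        (exponents {q} {p} d q≤p p<d)
<^ℚ⇒< {s} {K} {N} q@(mkℚ -[1+ n ] m-1 _) p@record{} d q≤p p<d s< =
  ^-cancelˡ-< m (*-cancelʳ-< (N ^ (suc n * b)) _ _ (begin-strict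
    (s ^ b * N) ^ m * N ^ (suc n * b)
      ≡⟨ cong₂ _*_ (^-distribʳ-* m (s ^ b) N) (sym (^-*-assoc N (suc n) b)) ⟩
    (s ^ b) ^ m * N ^ m * (N ^ suc n) ^ b
      ≡⟨ solve 3 (λ x y z → x :* y :* z := x :* z :* y) refl ((s ^ b) ^ m) (N ^ m) ((N ^ suc n) ^ b) ⟩
    (s ^ b) ^ m * (N ^ suc n) ^ b * N ^ m
      ≡⟨ cong (λ x → x * (N ^ suc n) ^ b * N ^ m) (^-swap s b m) ⟩
    (s ^ m) ^ b * (N ^ suc n) ^ b * N ^ m
      ≡⟨ cong (_* N ^ m) (^-distribʳ-* b (s ^ m) (N ^ suc n)) ⟨
    (s ^ m * N ^ suc n) ^ b * N ^ m
      <⟨ *-monoˡ-< (N ^ m) {{m^n≢0 N m}} (^-monoˡ-< b s<) ⟩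
    (K ^ m) ^ b * N ^ m           ≡⟨ cong (_* N ^ m) (^-swap K m b) ⟩
    (K ^ b) ^ m * N ^ m           ≤⟨ *-monoʳ-≤ ((K ^ b) ^ m) (^-monoʳ-≤ N e) ⟩
    (K ^ b) ^ m * N ^ (b * d * m + suc n * b)
      ≡⟨ cong ((K ^ b) ^ m *_) (^-distribˡ-+-* N (b * d * m) _) ⟩
    (K ^ b) ^ m * (N ^ (b * d * m) * N ^ (suc n * b))
      ≡⟨ *-assoc ((K ^ b) ^ m) _ _ ⟨
    (K ^ b) ^ m * N ^ (b * d * m) * N ^ (suc n * b)
      ≡⟨ cong (λ x → (K ^ b) ^ m * x * N ^ (suc n * b)) (^-*-assoc N (b * d) m) ⟨
    (K ^ b) ^ m * (N ^ (b * d)) ^ m * N ^ (suc n * b)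
      ≡⟨ cong (_* N ^ (suc n * b)) (^-distribʳ-* m (K ^ b) (N ^ (b * d))) ⟨
    (K ^ b * N ^ (b * d)) ^ m * N ^ (suc n * b) ∎))
  where
  open ≤-Reasoning
  open +-*-Solver
  b = ↧ₙ p
  m = suc m-1
  e′ : + m ℤ.≤ + (b * d * m) ℤ.+ + (suc n * b)
  e′ = subst (ℤ._≤ + (b * d * m) ℤ.+ + (suc n * b))
         (S.solve 2 (λ x y → (S.:- x) S.:+ y S.:+ x S.:= y) refl (+ (suc n * b)) (+ m))
         (ℤ.+-monoˡ-≤ (+ (suc n * b)) (exponents {q} {p} d q≤p p<d))
    where module S = ℤSolver.+-*-Solver
  e : m ≤ b * d * m + suc n * b
  e = ℤ.drop‿+≤+ (subst (+ m ℤ.≤_) (sym (ℤ.pos-+ (b * d * m) (suc n * b))) e′)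

module _ (em : ∀ {a} → ExcludedMiddle a) where

  -- The rational q that witnesses the bound varies with N, and nothing controls its denominator. If
  -- p is outside the cut r, however, every such q is at most p, and `<^ℚ⇒<` yields an inequality
  -- that mentions p only. That inequality fails for one suitably large N.
  ≤ᴿ-from-growth : ∀ d K r →
    (∀ N .{{_ : NonZero N}} → ∃ λ s → small N (suc d) ≤ s × s < K · N ^ᴿ r) →
    fromℕ d ≤ᴿ r
  ≤ᴿ-from-growth d K r growth {p} p<d with em {P = p ∈ ℝ.lower r}
  ... | yes p∈r = p∈r
  ... | no  p∉r = contradiction E*t<t (≤⇒≯ (m≤n*m t E {{m^n≢0 2 d}}))
    where
    b = ↧ₙ p
    E = 2 ^ d
    -- With N = E * t and s ≥ t ^ d, cancelling t ^ (b * d) leaves E * t < K ^ b * E ^ (b * d); t is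
    -- chosen above the right-hand side.
    t = suc (K ^ b * E ^ (b * d))
    N = E * t
    instance
      N≢0 : NonZero N
      N≢0 = m*n≢0 E t {{m^n≢0 2 d}}
    s   = proj₁ (growth N)
    s≥  = ≤-trans (small-lower d t) (proj₁ (proj₂ (growth N)))
    q   = proj₁ (proj₂ (proj₂ (growth N)))
    q∈r = proj₁ (proj₂ (proj₂ (proj₂ (growth N))))
    s<  = proj₂ (proj₂ (proj₂ (proj₂ (growth N))))
    q≤p : q ℚ.≤ p
    q≤p = ℚ.≮⇒≥ λ p<q → p∉r (ℝ.downward r p<q q∈r)
    open ≤-Reasoning
    open +-*-Solver
    E*t<t : E * t < t
    E*t<t = ≤-trans (*-cancelˡ-< (t ^ (b * d)) _ _ (begin-strict
      t ^ (b * d) * (E * t)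
        ≡⟨ cong (_* (E * t)) (trans (cong (t ^_) (*-comm b d)) (sym (^-*-assoc t d b))) ⟩
      (t ^ d) ^ b * (E * t)               ≤⟨ *-monoˡ-≤ (E * t) (^-monoˡ-≤ b s≥) ⟩
      s ^ b * N                           <⟨ <^ℚ⇒< q p d q≤p p<d s< ⟩
      K ^ b * (E * t) ^ (b * d)           ≡⟨ cong (K ^ b *_) (^-distribʳ-* (b * d) E t) ⟩
      K ^ b * (E ^ (b * d) * t ^ (b * d))
        ≡⟨ solve 3 (λ k e t → k :* (e :* t) := t :* (k :* e)) refl (K ^ b) (E ^ (b * d)) (t ^ (b * d)) ⟩
      t ^ (b * d) * (K ^ b * E ^ (b * d)) ∎)) (n≤1+n _)

-- Ramsey's theorem

private
  variable
    a : Level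
    n : ℕ

Increasing : ℕ → Vec ℕ n → Set
Increasing lo []      = ⊤
Increasing lo (x ∷ t) = lo ≤ x × Increasing (suc x) t

increasing-weaken : ∀ {lo lo′} (t : Vec ℕ n) → lo′ ≤ lo → Increasing lo t → Increasing lo′ t
increasing-weaken []      le inc         = tt
increasing-weaken (x ∷ t) le (lo≤ , inc) = ≤-trans le lo≤ , inc

increasing-map : ∀ {lo lo′} (g : ℕ → ℕ) (t : Vec ℕ n) → (∀ {i j} → i < j → g i < g j) →
                 (∀ {j} → lo ≤ j → lo′ ≤ g j) → Increasing lo t → Increasing lo′ (Vec.map g t)
increasing-map g []      mono bound inc         = tt
increasing-map g (x ∷ t) mono bound (lo≤ , inc) = bound lo≤ , increasing-map g t mono mono inc

increasing-injective : ∀ {g : ℕ → ℕ} → (∀ {i j} → i < j → g i < g j) → ∀ {i j} → g i ≡ g j → i ≡ j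
increasing-injective {g} mono {i} {j} eq with <-cmp i j
... | tri< i<j _ _ = contradiction (subst (_< g j) eq (mono i<j)) 1+n≰n
... | tri≈ _ i≡j _ = i≡j
... | tri> _ _ j<i = contradiction (subst (g j <_) eq (mono j<i)) 1+n≰n

Infinite : Pred ℕ 0ℓ → Set
Infinite S = ∀ n → ∃ λ m → n ≤ m × m ∈ S

Homogeneous : (Vec ℕ n → Set a) → Pred ℕ 0ℓ → Set a
Homogeneous R S = (∀ t → Increasing 0 t → All S t → R t) ⊎
                  (∀ t → Increasing 0 t → All S t → ¬ R t)

homogeneous-⊆ : ∀ {S S′ : Pred ℕ 0ℓ} (R : Vec ℕ n → Set a) → S′ ⊆ S →
                Homogeneous R S → Homogeneous R S′
homogeneous-⊆ R sub (inj₁ all)  = inj₁ λ t inc S′t → all t inc (All.map sub S′t)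
homogeneous-⊆ R sub (inj₂ none) = inj₂ λ t inc S′t → none t inc (All.map sub S′t)

module _ (em : ∀ {a} → ExcludedMiddle a) where

  -- Points are chosen one after another, and after each choice the remaining set is thinned until
  -- the truth of R at `x i ∷ t` no longer depends on t. Each point then has a colour of its own,
  -- and one of the two colours occurs infinitely often.
  ramsey : ∀ n (R : Vec ℕ n → Set a) (S : Pred ℕ 0ℓ) → Infinite S →
           ∃ λ S′ → S′ ⊆ S × Infinite S′ × Homogeneous R S′
  ramsey zero R S inf with em {P = R []}
  ... | yes r = S , id , inf , inj₁ λ { [] _ _ → r }
  ... | no ¬r = S , id , inf , inj₂ λ { [] _ _ → ¬r }
  ramsey {a = a} (suc n) R S₀ inf₀ = result
    where
    State : Set₁
    State = Σ (Pred ℕ 0ℓ) Infinite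

    point : State → ℕ
    point (S , inf) = proj₁ (inf 0)

    above : State → Pred ℕ 0ℓ
    above s@(S , _) m = point s < m × m ∈ S

    above-infinite : ∀ s → Infinite (above s)
    above-infinite s@(S , inf) n with m , le , m∈S ← inf (n ⊔ suc (point s)) =
      m , ≤-trans (m≤m⊔n n _) le , ≤-trans (m≤n⊔m n _) le , m∈S

    refined : ∀ s → ∃ λ S′ → S′ ⊆ above s × Infinite S′ × Homogeneous (R ∘ (point s ∷_)) S′
    refined s = ramsey n (R ∘ (point s ∷_)) (above s) (above-infinite s)

    state : ℕ → State
    state zero    = S₀ , inf₀
    state (suc i) = let S′ , _ , inf , _ = refined (state i) in S′ , inf

    x : ℕ → ℕ
    x i = point (state i)

    state-⊆ : ∀ i d → proj₁ (state (d + i)) ⊆ proj₁ (state i)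
    state-⊆ i zero    = id
    state-⊆ i (suc d) = state-⊆ i d ∘ proj₂ ∘ proj₁ (proj₂ (refined (state (d + i))))

    x∈state : ∀ i j → i ≤ j → x j ∈ proj₁ (state i)
    x∈state i j i≤j = state-⊆ i (j ∸ i)
      (subst (λ k → x j ∈ proj₁ (state k)) (sym (m∸n+n≡m i≤j)) (proj₂ (proj₂ (proj₂ (state j) 0))))

    x-mono : ∀ i j → i < j → x i < x j
    x-mono i j i<j = proj₁ (proj₁ (proj₂ (refined (state i))) (x∈state (suc i) j i<j))

    x-cancel : ∀ i j → x i < x j → i < j
    x-cancel i j lt with <-cmp i j
    ... | tri< i<j _ _  = i<j
    ... | tri≈ _ refl _ = contradiction lt (<-irrefl refl)
    ... | tri> _ _ j<i  = contradiction (x-mono j i j<i) (<-asym lt)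

    color : ∀ i → Homogeneous (R ∘ (x i ∷_)) (proj₁ (state (suc i)))
    color i = proj₂ (proj₂ (proj₂ (refined (state i))))

    -- Read off from the tag of `color i`, not stated through R: the colour classes then live in
    -- `Set`, as the subsets of ℕ do here, although R has values in an arbitrary level.
    IsAll IsNone : ℕ → Set
    IsAll i with color i
    ... | inj₁ _ = ⊤
    ... | inj₂ _ = ¬ ⊤
    IsNone i = ¬ IsAll i

    all-color : ∀ i → IsAll i → ∀ t → Increasing 0 t → All (proj₁ (state (suc i))) t → R (x i ∷ t)
    all-color i p with color i
    ... | inj₁ all = all
    ... | inj₂ _   = contradiction tt p

    none-color : ∀ i → IsNone i → ∀ t → Increasing 0 t → All (proj₁ (state (suc i))) t → ¬ R (x i ∷ t)
    none-color i p with color i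
    ... | inj₁ _    = contradiction tt p
    ... | inj₂ none = none

    pick : Pred ℕ 0ℓ → Pred ℕ 0ℓ
    pick P m = ∃ λ i → P i × m ≡ x i

    i≤x : ∀ i → i ≤ x i
    i≤x zero    = z≤n
    i≤x (suc i) = ≤-trans (s≤s (i≤x i)) (x-mono i (suc i) ≤-refl)

    pick-infinite : ∀ {P} → Infinite P → Infinite (pick P)
    pick-infinite inf n with i , n≤i , p ← inf n = x i , ≤-trans n≤i (i≤x i) , i , p , refl

    pick-⊆ : ∀ P → pick P ⊆ S₀
    pick-⊆ P (i , _ , refl) = x∈state 0 i z≤n

    tail-∈ : ∀ {P m} i (t : Vec ℕ m) → Increasing (suc (x i)) t → All (pick P) t →
             All (proj₁ (state (suc i))) t
    tail-∈ i []      inc         []                    = []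
    tail-∈ i (_ ∷ t) (lt , inc) ((j , _ , refl) ∷ ps) =
      x∈state (suc i) j (x-cancel i j lt) ∷ tail-∈ i t (increasing-weaken t (≤-trans lt (n≤1+n _)) inc) ps

    result : ∃ λ S′ → S′ ⊆ S₀ × Infinite S′ × Homogeneous R S′
    result with em {P = Infinite IsAll}
    ... | yes inf = pick IsAll , pick-⊆ IsAll , pick-infinite inf ,
      inj₁ λ { (_ ∷ t) (_ , inc) ((i , p , refl) ∷ ps) →
        all-color i p t (increasing-weaken t z≤n inc) (tail-∈ i t inc ps) }
    ... | no ¬inf = pick IsNone , pick-⊆ IsNone , pick-infinite none-infinite ,
      inj₂ λ { (_ ∷ t) (_ , inc) ((i , p , refl) ∷ ps) →
        none-color i p t (increasing-weaken t z≤n inc) (tail-∈ i t inc ps) }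
      where
      none-infinite : Infinite IsNone
      none-infinite n with em {P = ∃ λ i → n ≤ i × IsNone i}
      ... | yes found = found
      ... | no  none  = contradiction (λ m → m ⊔ n , m≤m⊔n m n , all (m ⊔ n) (m≤n⊔m m n)) ¬inf
        where
        all : ∀ i → n ≤ i → IsAll i
        all i n≤i with em {P = IsAll i}
        ... | yes p = p
        ... | no ¬p = contradiction (i , n≤i , ¬p) none

  enumerate : ∀ S → Infinite S →
              ∃ λ g → (∀ i → g i ∈ S) × (∀ {i j} → i < j → g i < g j)
  enumerate S inf = g , g∈S , g-mono
    where
    g : ℕ → ℕ
    g zero    = proj₁ (inf 0)
    g (suc i) = proj₁ (inf (suc (g i)))
    g∈S : ∀ i → g i ∈ S
    g∈S zero    = proj₂ (proj₂ (inf 0))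
    g∈S (suc i) = proj₂ (proj₂ (inf (suc (g i))))
    g-mono : ∀ {i j} → i < j → g i < g j
    g-mono {i} {suc j} (s≤s i≤j) with m≤n⇒m<n∨m≡n i≤j
    ... | inj₁ i<j  = <-trans (g-mono i<j) (proj₁ (proj₂ (inf (suc (g j)))))
    ... | inj₂ refl = proj₁ (proj₂ (inf (suc (g j))))

  Monochromatic : (ℕ → ℕ) → (Σ ℕ λ n → Vec ℕ n → Set a) → Set a
  Monochromatic g (n , R) = (∀ t → Increasing 0 t → R (Vec.map g t)) ⊎
                            (∀ t → Increasing 0 t → ¬ R (Vec.map g t))

  ramsey-sets : (Rs : List (Σ ℕ λ n → Vec ℕ n → Set a)) →
    ∃ λ S → Infinite S × Allᴸ (λ (n , R) → Homogeneous R S) Rs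
  ramsey-sets []             = (λ _ → ⊤) , (λ n → n , ≤-refl , tt) , []
  ramsey-sets ((n , R) ∷ Rs) with S , inf , homs ← ramsey-sets Rs
                             with S′ , sub , inf′ , hom ← ramsey n R S inf =
    S′ , inf′ , hom ∷ Allᴸ.map (λ {(_ , R)} → homogeneous-⊆ R sub) homs

  ramsey-list : (Rs : List (Σ ℕ λ n → Vec ℕ n → Set a)) →
    ∃ λ (g : ℕ → ℕ) → (∀ {i j} → i < j → g i < g j) × Allᴸ (Monochromatic g) Rs
  ramsey-list {a = a} Rs with ramsey-sets Rs
  ... | S , inf , homs with enumerate S inf
  ...   | g , g∈S , g-mono = g , g-mono , Allᴸ.map along homs
    where
    inc : ∀ {n} (t : Vec ℕ n) → Increasing 0 t → Increasing 0 (Vec.map g t)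
    inc t = increasing-map g t g-mono λ _ → z≤n
    all : ∀ {n} (t : Vec ℕ n) → All S (Vec.map g t)
    all []      = []
    all (x ∷ t) = g∈S x ∷ all t
    along : ∀ {nR} → Homogeneous {a = a} (proj₂ nR) S → Monochromatic g nR
    along (inj₁ ev) = inj₁ λ t t-inc → ev (Vec.map g t) (inc t t-inc) (all t)
    along (inj₂ nv) = inj₂ λ t t-inc → nv (Vec.map g t) (inc t t-inc) (all t)

increasing-tabulate : ∀ {n lo} (f : Fin n → ℕ) → (∀ {s t} → s Fin.< t → f s < f t) →
                      (∀ t → lo ≤ f t) → Increasing lo (tabulate f)
increasing-tabulate {zero}  f mono lo≤ = _
increasing-tabulate {suc n} f mono lo≤ =
  lo≤ zero , increasing-tabulate (f ∘ suc) (mono ∘ s≤s) (λ t → mono (s≤s z≤n))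

blocks : ∀ {n N k} → (Fin n → Fin N) → Vec (Fin (N * k)) (n * k)
blocks i = concat (tabulate λ t → tabulate (Fin.combine (i t)))

lookup-blocks : ∀ {a} {A : Set a} {n N k} (bs : Vec (Vec A k) N) (i : Fin n → Fin N) →
                Vec.map (lookup (concat bs)) (blocks i) ≡ concat (tabulate (lookup bs ∘ i))
lookup-blocks bs i = trans
  (map-concat (lookup (concat bs)) (tabulate λ t → tabulate (Fin.combine (i t)))) (cong concat
  (trans (sym (tabulate-∘ (Vec.map (lookup (concat bs))) _)) (tabulate-cong λ t →
    trans (sym (tabulate-∘ (lookup (concat bs)) (Fin.combine (i t))))
      (trans (tabulate-cong (lookup-concat bs (i t))) (tabulate∘lookup (lookup bs (i t)))))))

<-fromℕ : ∀ q d → ℤ.∣ ↥ q ∣ < d → q ℚ.< + d ℚ./ 1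
<-fromℕ (mkℚ (+ n)    b _) d       n<d rewrite fromℕ-normal d = ℚ.*<*
  (subst₂ ℤ._<_ (sym (ℤ.*-identityʳ (+ n))) (ℤ.pos-* d (suc b))
    (ℤ.+<+ (≤-trans n<d (m≤m*n d (suc b)))))
<-fromℕ (mkℚ -[1+ n ] b _) (suc d) n<d rewrite fromℕ-normal (suc d) = ℚ.*<* ℤ.-<+

-- Definability and saturation

module _ {ℓ} {L : Language ℓ} where

  rename-term  : ∀ {m n} → Vec (Fin m) n → Term L n → Term L m
  rename-terms : ∀ {m n k} → Vec (Fin m) n → Vec (Term L n) k → Vec (Term L m) k

  rename-term is (var i)    = var (lookup is i)
  rename-term is (app f ts) = app f (rename-terms is ts)

  rename-terms is []       = []
  rename-terms is (t ∷ ts) = rename-term is t ∷ rename-terms is ts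

  rename : ∀ {m n} → Vec (Fin m) n → Formula L n → Formula L m
  rename is (s ≈′ t)   = rename-term is s ≈′ rename-term is t
  rename is (rel R ts) = rel R (rename-terms is ts)
  rename is ⊥′         = ⊥′
  rename is (φ ⇒ ψ)    = rename is φ ⇒ rename is ψ
  rename is (∀′ φ)     = ∀′ rename (zero ∷ Vec.map suc is) φ

  infixr 6 _∧′_

  ⊤′ : ∀ {n} → Formula L n
  ⊤′ = ⊥′ ⇒ ⊥′

  _∧′_ : ∀ {n} → Formula L n → Formula L n → Formula L n
  φ ∧′ ψ = ¬′ (φ ⇒ (¬′ ψ))

  ∃′_ : ∀ {n} → Formula L (suc n) → Formula L n
  ∃′ φ = ¬′ (∀′ (¬′ φ))

  ⋀ : ∀ {n} → List (Formula L n) → Formula L n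
  ⋀ = List.foldr _∧′_ ⊤′

  ∃* : ∀ l {n} → Formula L (l + n) → Formula L n
  ∃* zero    φ = φ
  ∃* (suc l) φ = ∃* l (∃′ φ)

lookup-↑ˡ : ∀ {a} {A : Set a} {m n} (xs : Vec A m) (ys : Vec A n) →
            Vec.map (lookup (xs ++ ys)) (tabulate (_↑ˡ n)) ≡ xs
lookup-↑ˡ xs ys = trans (sym (tabulate-∘ (lookup (xs ++ ys)) _))
  (trans (tabulate-cong (lookup-++ˡ xs ys)) (tabulate∘lookup xs))

lookup-↑ʳ : ∀ {a} {A : Set a} {m n k} (xs : Vec A m) (ys : Vec A n) (is : Vec (Fin n) k) →
            Vec.map (lookup (xs ++ ys)) (Vec.map (m ↑ʳ_) is) ≡ Vec.map (lookup ys) is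
lookup-↑ʳ xs ys is = trans (sym (map-∘ _ _ is)) (map-cong (lookup-++ʳ xs ys) is)

module _ (em : ∀ {a} → ExcludedMiddle a)
         {ℓ} {L : Language ℓ} (M : Structure L) where
  open Structure M
  open Semantics M

  eval-rename : ∀ {m n} (is : Vec (Fin m) n) ρ t →
                eval ρ (rename-term is t) ≡ eval (Vec.map (lookup ρ) is) t
  evals-rename : ∀ {m n k} (is : Vec (Fin m) n) ρ (ts : Vec _ k) →
                 evals ρ (rename-terms is ts) ≡ evals (Vec.map (lookup ρ) is) ts

  eval-rename (i ∷ is) ρ (var zero)    = refl
  eval-rename (i ∷ is) ρ (var (suc j)) = eval-rename is ρ (var j)
  eval-rename is       ρ (app f ts)    = cong (fun f) (evals-rename is ρ ts)

  evals-rename is ρ []       = refl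
  evals-rename is ρ (t ∷ ts) = cong₂ _∷_ (eval-rename is ρ t) (evals-rename is ρ ts)

  sat-rename : ∀ {m n} (is : Vec (Fin m) n) φ ρ →
               Sat (rename is φ) ρ ⇔ Sat φ (Vec.map (lookup ρ) is)
  sat-rename is (s ≈′ t)   ρ rewrite eval-rename is ρ s | eval-rename is ρ t = mk⇔ id id
  sat-rename is (rel R ts) ρ rewrite evals-rename is ρ ts = mk⇔ id id
  sat-rename is ⊥′         ρ = mk⇔ id id
  sat-rename is (φ ⇒ ψ)    ρ = mk⇔
    (λ f → to (sat-rename is ψ ρ) ∘ f ∘ from (sat-rename is φ ρ))
    (λ f → from (sat-rename is ψ ρ) ∘ f ∘ to (sat-rename is φ ρ))
  sat-rename is (∀′ φ)     ρ = mk⇔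
    (λ f x → subst (Sat φ) (under x) (to (sat-rename (zero ∷ Vec.map suc is) φ (x ∷ ρ)) (f x)))
    (λ f x → from (sat-rename (zero ∷ Vec.map suc is) φ (x ∷ ρ)) (subst (Sat φ) (sym (under x)) (f x)))
    where
    under : ∀ x → Vec.map (lookup (x ∷ ρ)) (zero ∷ Vec.map suc is) ≡ x ∷ Vec.map (lookup ρ) is
    under x = cong (x ∷_) (sym (map-∘ (lookup (x ∷ ρ)) suc is))

  stable : ∀ {p} {P : Set p} → ¬ ¬ P → P
  stable = decidable-stable em

  sat-∧ : ∀ {n} (φ ψ : Formula L n) ρ → Sat (φ ∧′ ψ) ρ ⇔ (Sat φ ρ × Sat ψ ρ)
  sat-∧ φ ψ ρ = mk⇔
    (λ f → stable λ ¬both → lower (f λ x y → contradiction (x , y) ¬both))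
    (λ (x , y) f → f x y)

  sat-⋀ : ∀ {n} (φs : List (Formula L n)) ρ → Sat (⋀ φs) ρ ⇔ Allᴸ (λ φ → Sat φ ρ) φs
  sat-⋀ []       ρ = mk⇔ (λ _ → []) (λ _ → id)
  sat-⋀ (φ ∷ φs) ρ = mk⇔
    (λ s → let x , y = to (sat-∧ φ (⋀ φs) ρ) s in x ∷ to (sat-⋀ φs ρ) y)
    (λ { (x ∷ y) → from (sat-∧ φ (⋀ φs) ρ) (x , from (sat-⋀ φs ρ) y) })

  sat-∃ : ∀ {n} (φ : Formula L (suc n)) ρ → Sat (∃′ φ) ρ ⇔ (∃ λ x → Sat φ (x ∷ ρ))
  sat-∃ φ ρ = mk⇔
    (λ f → stable λ none → lower (f λ x s → contradiction (x , s) none))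
    (λ (x , s) f → f x s)

  sat-∃* : ∀ l {n} (φ : Formula L (l + n)) ρ → Sat (∃* l φ) ρ ⇔ (∃ λ e → Sat φ (e ++ ρ))
  sat-∃* zero    φ ρ = mk⇔ (λ s → [] , s) (λ { ([] , s) → s })
  sat-∃* (suc l) φ ρ = mk⇔
    (λ s → let e , t = to (sat-∃* l (∃′ φ) ρ) s
               x , u = to (sat-∃ φ (e ++ ρ)) t
           in x ∷ e , u)
    (λ { (x ∷ e , u) → from (sat-∃* l (∃′ φ) ρ) (e , from (sat-∃ φ (e ++ ρ)) (x , u)) })

  module _ (monster : IsMonster M) where
    open IsMonster monster

    -- Largeness embeds the set of formulas into the model, and the formulas ⊥′ in different numbers
    -- of variables are distinct; this provides infinitely many elements.
    element : ℕ → Carrier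
    element n = Injection.to (proj₁ large) (n , ⊥′)

    element-injective : ∀ {m n} → element m ≡ element n → m ≡ n
    element-injective eq = cong proj₁ (Injection.injective (proj₁ large) eq)

    finite-small : ∀ {i} (c : Vec Carrier i) → (setoid Carrier ∣ˢ (_∈ⱽ c)) ≺ setoid Carrier
    finite-small c =
      record { to = proj₁ ; cong = id ; injective = id } ,
      λ ι → ℕ→Fin-notInjective (position ι) (position-injective ι)
      where
      module _ (ι : Injection (setoid Carrier) (setoid Carrier ∣ˢ (_∈ⱽ c))) where
        member : ∀ n → proj₁ (Injection.to ι (element n)) ∈ⱽ c
        member n = proj₂ (Injection.to ι (element n))
        position : ℕ → Fin _
        position n = indexⱽ (member n)
        position-injective : ∀ {m n} → position m ≡ position n → m ≡ n
        position-injective {m} {n} eq = element-injective (Injection.injective ι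
          (trans (lookup-indexⱽ (member m))
                 (trans (cong (lookup c) eq) (sym (lookup-indexⱽ (member n))))))

    FinitelySatisfiable : ∀ n {i} → Vec Carrier i → Pred (Formula L (n + i)) ℓ → Set ℓ
    FinitelySatisfiable n c I =
      ∀ Δ → Allᴸ I Δ → ∃ λ (e : Vec Carrier n) → Allᴸ (λ ψ → Sat ψ (e ++ c)) Δ

    saturation₁ : ∀ {i} (c : Vec Carrier i) (I : Pred (Formula L (1 + i)) ℓ) →
                  FinitelySatisfiable 1 c I → ∃ λ x → ∀ {ψ} → ψ ∈ I → Sat ψ (x ∷ c)
    saturation₁ {i} c I satisfiable =
      let x , realizes = saturated (_∈ⱽ c) (finite-small c) p p-over consistent
      in x , λ {ψ} ψ∈I → realizes (ψ , ψ∈I , refl)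
      where
      p : Pred (Formulaᴹ M 1) ℓ
      p θ = ∃ λ ψ → ψ ∈ I × θ ≡ (i , ψ , c)
      members : ∀ {j} (d : Vec Carrier j) → All (_∈ⱽ d) d
      members []      = []
      members (x ∷ d) = here refl ∷ All.map there (members d)
      p-over : p ⊆ Over M (_∈ⱽ c)
      p-over (ψ , _ , refl) = members c
      formulas : ∀ {θs} → Allᴸ p θs → List (Formula L (1 + i))
      formulas []             = []
      formulas ((ψ , _) ∷ ps) = ψ ∷ formulas ps
      formulas-∈ : ∀ {θs} (ps : Allᴸ p θs) → Allᴸ I (formulas ps)
      formulas-∈ []                 = []
      formulas-∈ ((_ , ψ∈I , _) ∷ ps) = ψ∈I ∷ formulas-∈ ps
      transfer : ∀ {θs e} (ps : Allᴸ p θs) → Allᴸ (λ ψ → Sat ψ (e ++ c)) (formulas ps) →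
                 Allᴸ (Satᴹ M e) θs
      transfer []                  []       = []
      transfer ((_ , _ , refl) ∷ ps) (s ∷ ss) = s ∷ transfer ps ss
      consistent : Consistent M p
      consistent θs ps =
        let e , ss = satisfiable (formulas ps) (formulas-∈ ps) in e , transfer ps ss

    -- The variable in front is chosen last. The others first realize ∃x ⋀ Δ for every finite part Δ
    -- of I, and this is precisely what makes I finitely satisfiable in the front variable once they
    -- are fixed.
    saturation* : ∀ n {i} (c : Vec Carrier i) (I : Pred (Formula L (n + i)) ℓ) →
                 FinitelySatisfiable n c I → ∃ λ e → ∀ {ψ} → ψ ∈ I → Sat ψ (e ++ c)
    saturation* zero c I satisfiable = [] , λ {ψ} ψ∈I → single ψ ψ∈I (satisfiable (ψ ∷ []) (ψ∈I ∷ []))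
      where
      single : ∀ ψ → ψ ∈ I → (∃ λ e → Allᴸ (λ ψ → Sat ψ (e ++ c)) (ψ ∷ [])) → Sat ψ c
      single ψ _ ([] , s ∷ []) = s
    saturation* (suc n) {i} c I satisfiable =
      let e , realizes = saturation* n c I′ satisfiable′
          x , realizes′ = saturation₁ (e ++ c) I λ Δ Δ⊆I →
            let y , s = to (sat-∃ (⋀ Δ) (e ++ c)) (realizes (Δ , Δ⊆I , refl))
            in [ y ] , to (sat-⋀ Δ (y ∷ e ++ c)) s
      in x ∷ e , realizes′
      where
      I′ : Pred (Formula L (n + i)) ℓ
      I′ χ = ∃ λ Δ → Allᴸ I Δ × χ ≡ ∃′ (⋀ Δ)
      gather : ∀ {χs} → Allᴸ I′ χs → List (Formula L (suc n + i))
      gather []             = []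
      gather ((Δ , _) ∷ ps) = Δ List.++ gather ps
      gather-∈ : ∀ {χs} (ps : Allᴸ I′ χs) → Allᴸ I (gather ps)
      gather-∈ []                   = []
      gather-∈ ((_ , Δ⊆I , _) ∷ ps) = Allᴸ.++⁺ Δ⊆I (gather-∈ ps)
      transfer : ∀ {χs x e} (ps : Allᴸ I′ χs) → Allᴸ (λ ψ → Sat ψ (x ∷ e ++ c)) (gather ps) →
                 Allᴸ (λ χ → Sat χ (e ++ c)) χs
      transfer []                   ss = []
      transfer {x = x} {e} ((Δ , _ , refl) ∷ ps) ss =
        from (sat-∃ (⋀ Δ) (e ++ c)) (x , from (sat-⋀ Δ (x ∷ e ++ c)) (Allᴸ.++⁻ˡ Δ ss))
        ∷ transfer ps (Allᴸ.++⁻ʳ Δ ss)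
      satisfiable′ : FinitelySatisfiable n c I′
      satisfiable′ χs ps with satisfiable (gather ps) (gather-∈ ps)
      ... | x ∷ e , ss = e , transfer ps ss

    saturation-∅ : ∀ n (I : Pred (Formula L n) ℓ) →
                  (∀ Δ → Allᴸ I Δ → ∃ λ e → Allᴸ (λ ψ → Sat ψ e) Δ) →
                  ∃ λ e → ∀ {ψ} → ψ ∈ I → Sat ψ e
    saturation-∅ n I satisfiable =
      let e , realizes = saturation* n [] I⁰ λ Δ ps →
            let e , ss = satisfiable (formulas ps) (formulas-∈ ps) in e , transfer e ps ss
      in e , λ {ψ} ψ∈I → to (weaken-sat ψ e) (realizes (ψ , ψ∈I , refl))
      where
      weaken : Formula L n → Formula L (n + 0)
      weaken = rename (tabulate (_↑ˡ 0))
      weaken-sat : ∀ ψ e → Sat (weaken ψ) (e ++ []) ⇔ Sat ψ e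
      weaken-sat ψ e = subst (λ ρ → Sat (weaken ψ) (e ++ []) ⇔ Sat ψ ρ) (lookup-↑ˡ e [])
        (sat-rename (tabulate (_↑ˡ 0)) ψ (e ++ []))
      I⁰ : Pred (Formula L (n + 0)) ℓ
      I⁰ χ = ∃ λ ψ → ψ ∈ I × χ ≡ weaken ψ
      formulas : ∀ {χs} → Allᴸ I⁰ χs → List (Formula L n)
      formulas []             = []
      formulas ((ψ , _) ∷ ps) = ψ ∷ formulas ps
      formulas-∈ : ∀ {χs} (ps : Allᴸ I⁰ χs) → Allᴸ I (formulas ps)
      formulas-∈ []                   = []
      formulas-∈ ((_ , ψ∈I , _) ∷ ps) = ψ∈I ∷ formulas-∈ ps
      transfer : ∀ {χs} e (ps : Allᴸ I⁰ χs) → Allᴸ (λ ψ → Sat ψ e) (formulas ps) →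
                 Allᴸ (λ χ → Sat χ (e ++ [])) χs
      transfer e []                    []       = []
      transfer e ((ψ , _ , refl) ∷ ps) (s ∷ ss) = from (weaken-sat ψ e) s ∷ transfer e ps ss

  -- Truth patterns of φ

  module Patterns (l k : ℕ) (φ : Formula L (l + k)) where

    literal : Bool → Formula L (l + k)
    literal true  = φ
    literal false = ¬′ φ

    Matches : ∀ {n} → Vec Carrier l → Vec (Vec Carrier k) n → Vec Bool n → Set ℓ
    Matches c bs w = ∀ i → Sat (literal (lookup w i)) (c ++ lookup bs i)

    Realized : ∀ {n} → Vec (Vec Carrier k) n → Vec Bool n → Set ℓ
    Realized bs w = ∃ λ c → Matches c bs w

    private
      first-block : ∀ r → Vec (Fin (l + (k + r))) (l + k)
      first-block r = tabulate (_↑ˡ (k + r)) ++ Vec.map (l ↑ʳ_) (tabulate (_↑ˡ r))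

      later-blocks : ∀ r → Vec (Fin (l + (k + r))) (l + r)
      later-blocks r = tabulate (_↑ˡ (k + r)) ++ Vec.map (l ↑ʳ_) (Vec.map (k ↑ʳ_) (tabulate id))

      lookup-first : ∀ {r} (c : Vec Carrier l) (b : Vec Carrier k) (bs : Vec Carrier r) →
                    Vec.map (lookup (c ++ (b ++ bs))) (first-block r) ≡ c ++ b
      lookup-first {r} c b bs = trans
        (map-++ _ (tabulate {n = l} (_↑ˡ (k + r))) (Vec.map (l ↑ʳ_) (tabulate (_↑ˡ r))))
        (cong₂ _++_ (lookup-↑ˡ c (b ++ bs))
          (trans (lookup-↑ʳ c (b ++ bs) (tabulate (_↑ˡ r))) (lookup-↑ˡ b bs)))

      lookup-later : ∀ {r} (c : Vec Carrier l) (b : Vec Carrier k) (bs : Vec Carrier r) →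
                     Vec.map (lookup (c ++ (b ++ bs))) (later-blocks r) ≡ c ++ bs
      lookup-later {r} c b bs = trans
        (map-++ _ (tabulate {n = l} (_↑ˡ (k + r))) (Vec.map (l ↑ʳ_) (Vec.map (k ↑ʳ_) (tabulate id))))
        (cong₂ _++_ (lookup-↑ˡ c (b ++ bs))
          (trans (lookup-↑ʳ c (b ++ bs) (Vec.map (k ↑ʳ_) (tabulate id)))
            (trans (lookup-↑ʳ b bs (tabulate id))
              (trans (sym (tabulate-∘ (lookup bs) id)) (tabulate∘lookup bs)))))

    matches : ∀ {n} → Vec Bool n → Formula L (l + n * k)
    matches []      = ⊤′
    matches (y ∷ w) = rename (first-block _) (literal y) ∧′ rename (later-blocks _) (matches w)

    sat-matches : ∀ {n} c (bs : Vec (Vec Carrier k) n) w →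
                  Sat (matches w) (c ++ concat bs) ⇔ Matches c bs w
    sat-matches c []       []      = mk⇔ (λ _ ()) (λ _ → id)
    sat-matches {suc n} c (b ∷ bs) (y ∷ w) = mk⇔
      (λ s → let s₁ , s₂ = to (sat-∧ θ₁ θ₂ ρ) s in λ where
        zero    → to first s₁
        (suc i) → to (sat-matches c bs w) (to rest s₂) i)
      (λ m → from (sat-∧ θ₁ θ₂ ρ)
        (from first (m zero) , from rest (from (sat-matches c bs w) (m ∘ suc))))
      where
      ρ = c ++ (b ++ concat bs)
      θ₁ = rename (first-block (n * k)) (literal y)
      θ₂ = rename (later-blocks (n * k)) (matches w)
      first : Sat θ₁ ρ ⇔ Sat (literal y) (c ++ b)
      first = subst (λ σ → Sat θ₁ ρ ⇔ Sat (literal y) σ) (lookup-first c b (concat bs))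
                (sat-rename (first-block (n * k)) (literal y) ρ)
      rest : Sat θ₂ ρ ⇔ Sat (matches w) (c ++ concat bs)
      rest = subst (λ σ → Sat θ₂ ρ ⇔ Sat (matches w) σ) (lookup-later c b (concat bs))
               (sat-rename (later-blocks (n * k)) (matches w) ρ)

    realized : ∀ {n} → Vec Bool n → Formula L (n * k)
    realized w = ∃* l (matches w)

    sat-realized : ∀ {n} (bs : Vec (Vec Carrier k) n) w →
                   Sat (realized w) (concat bs) ⇔ Realized bs w
    sat-realized bs w = mk⇔
      (λ s → let c , t = to (sat-∃* l (matches w) (concat bs)) s in c , to (sat-matches c bs w) t)
      (λ (c , m) → from (sat-∃* l (matches w) (concat bs)) (c , from (sat-matches c bs w) m))

-- Types as finitely realized subsets

module Types (em : ∀ {a} → ExcludedMiddle a)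
             {ℓ} {L : Language ℓ} (M : Structure L)
             (l k : ℕ) (φ : Formula L (l + k)) where
  open Structure M
  open Semantics M
  open Patterns em M l k φ

  private
    Params : Set ℓ
    Params = Vec Carrier k

    conflict : ∀ {p : Pred (Formulaᴹ M l) ℓ} {𝐚} → Consistent M p →
               φ⁺ M l k φ 𝐚 ∈ p → φ⁻ M l k φ 𝐚 ∈ p → ∀ {z} {Z : Set z} → Z
    conflict con pos neg with _ , s ∷ s′ ∷ [] ← con _ (pos ∷ neg ∷ []) =
      contradiction (s′ s) lower

  Agrees : Pred Params ℓ → Vec Carrier l → Params → Set ℓ
  Agrees X c 𝐚 = Sat φ (c ++ 𝐚) ⇔ 𝐚 ∈ X

  -- The set p asserts φ(x,𝐚) on X and its negation on the rest of A, so it decides every 𝐚 in A. A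
  -- consistent set containing p has no room for the opposite of any of these formulas, hence
  -- maximality.
  finitely-realized⇒type : ∀ (A X : Pred Params ℓ) → X ⊆ A →
    (∀ as → Allᴸ A as → ∃ λ c → Allᴸ (Agrees X c) as) → X ∈ Sφ M l k φ A
  finitely-realized⇒type A X X⊆A realize = p ,
    record { overA = overA ; consistent = consistent ; maximal = maximal } ,
    (λ {𝐚} 𝐚∈X → X⊆A 𝐚∈X , 𝐚 , X⊆A 𝐚∈X , inj₁ (𝐚∈X , refl)) ,
    λ {𝐚} (𝐚∈A , pos) → decidable-stable em λ 𝐚∉X →
      conflict consistent pos (𝐚 , 𝐚∈A , inj₂ (𝐚∉X , refl))
    where
    p : Pred (Formulaᴹ M l) ℓ
    p θ = ∃ λ 𝐚 → 𝐚 ∈ A × ((𝐚 ∈ X × θ ≡ φ⁺ M l k φ 𝐚) ⊎ (𝐚 ∉ X × θ ≡ φ⁻ M l k φ 𝐚))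
    overA : p ⊆ ±φ M l k φ A
    overA (𝐚 , 𝐚∈A , inj₁ (_ , eq)) = 𝐚 , 𝐚∈A , inj₁ eq
    overA (𝐚 , 𝐚∈A , inj₂ (_ , eq)) = 𝐚 , 𝐚∈A , inj₂ eq
    params : ∀ {θs} → Allᴸ p θs → List Params
    params []             = []
    params ((𝐚 , _) ∷ ps) = 𝐚 ∷ params ps
    params-∈ : ∀ {θs} (ps : Allᴸ p θs) → Allᴸ A (params ps)
    params-∈ []                   = []
    params-∈ ((_ , 𝐚∈A , _) ∷ ps) = 𝐚∈A ∷ params-∈ ps
    transfer : ∀ {θs c} (ps : Allᴸ p θs) → Allᴸ (Agrees X c) (params ps) → Allᴸ (Satᴹ M c) θs
    transfer []                                   []       = []
    transfer ((_ , _ , inj₁ (𝐚∈X , refl)) ∷ ps) (g ∷ gs) = from g 𝐚∈X ∷ transfer ps gs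
    transfer ((_ , _ , inj₂ (𝐚∉X , refl)) ∷ ps) (g ∷ gs) =
      (λ s → lift (𝐚∉X (to g s))) ∷ transfer ps gs
    consistent : Consistent M p
    consistent θs ps = let c , gs = realize (params ps) (params-∈ ps) in c , transfer ps gs
    maximal : ∀ q → q ⊆ ±φ M l k φ A → Consistent M q → p ⊆ q → q ⊆ p
    maximal q q⊆ con p⊆q θ∈q with q⊆ θ∈q
    ... | 𝐚 , 𝐚∈A , eq with em {P = 𝐚 ∈ X}
    ...   | yes 𝐚∈X with eq
    ...     | inj₁ refl = 𝐚 , 𝐚∈A , inj₁ (𝐚∈X , refl)
    ...     | inj₂ refl = conflict con (p⊆q (𝐚 , 𝐚∈A , inj₁ (𝐚∈X , refl))) θ∈q
    maximal q q⊆ con p⊆q θ∈q | 𝐚 , 𝐚∈A , eq | no 𝐚∉X with eq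
    ...     | inj₁ refl = conflict con θ∈q (p⊆q (𝐚 , 𝐚∈A , inj₂ (𝐚∉X , refl)))
    ...     | inj₂ refl = 𝐚 , 𝐚∈A , inj₂ (𝐚∉X , refl)

  module _ {A : Pred Params ℓ} {p : Pred (Formulaᴹ M l) ℓ} (type : IsφType M l k φ A p) where
    open IsφType type

    private
      Extended : Formulaᴹ M l → Pred (Formulaᴹ M l) ℓ
      Extended η θ = θ ∈ p ⊎ θ ≡ η

      old : ∀ {η θs} → Allᴸ (Extended η) θs → List (Formulaᴹ M l)
      old []                       = []
      old {θs = θ ∷ _} (inj₁ _ ∷ ps) = θ ∷ old ps
      old (inj₂ _ ∷ ps)            = old ps

      old-∈ : ∀ {η θs} (ps : Allᴸ (Extended η) θs) → Allᴸ p (old ps)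
      old-∈ []              = []
      old-∈ (inj₁ θ∈p ∷ ps) = θ∈p ∷ old-∈ ps
      old-∈ (inj₂ _ ∷ ps)   = old-∈ ps

      old-sat : ∀ {η θs c} (ps : Allᴸ (Extended η) θs) → Allᴸ (Satᴹ M c) (old ps) →
                Satᴹ M c η → Allᴸ (Satᴹ M c) θs
      old-sat []               ss       sη = []
      old-sat (inj₁ _ ∷ ps)    (s ∷ ss) sη = s ∷ old-sat ps ss sη
      old-sat (inj₂ refl ∷ ps) ss       sη = sη ∷ old-sat ps ss sη

      extend : ∀ {η} → η ∈ ±φ M l k φ A → Consistent M (Extended η) → η ∈ p
      extend {η} η∈ con = maximal (Extended η)
        (λ { (inj₁ θ∈p) → overA θ∈p ; (inj₂ refl) → η∈ }) con inj₁ (inj₂ refl)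

    -- Suppose that neither formula could be added consistently, with finite sets θs and θs′ as
    -- witnesses. An element realizing the parts of both that lie in p satisfies φ(x,𝐚) or its
    -- negation, and so realizes one of the two sets after all.
    type-complete : ∀ {𝐚} → 𝐚 ∈ A → φ⁺ M l k φ 𝐚 ∈ p ⊎ φ⁻ M l k φ 𝐚 ∈ p
    type-complete {𝐚} 𝐚∈A with em {P = Consistent M (Extended (φ⁺ M l k φ 𝐚))}
    ... | yes con  = inj₁ (extend (𝐚 , 𝐚∈A , inj₁ refl) con)
    ... | no  ¬con = inj₂ (extend (𝐚 , 𝐚∈A , inj₂ refl) λ θs ps →
      decidable-stable em λ none → ¬con λ θs′ ps′ →
        let c , ss = consistent (old ps ++ᴸ old ps′) (Allᴸ.++⁺ (old-∈ ps) (old-∈ ps′))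
            sat-φ  = decidable-stable em λ ¬sat →
                       none (c , old-sat ps (Allᴸ.++⁻ˡ (old ps) ss) (λ s → lift (¬sat s)))
        in c , old-sat ps′ (Allᴸ.++⁻ʳ (old ps) ss) sat-φ)

    type-realized : ∀ as → Allᴸ A as →
      ∃ λ c → Allᴸ (λ 𝐚 → Sat φ (c ++ 𝐚) ⇔ φ⁺ M l k φ 𝐚 ∈ p) as
    type-realized as as∈A = let c , ss = consistent (chosen as∈A) (chosen-∈ as∈A)
                            in c , transfer as∈A ss
      where
      chosen : ∀ {as} → Allᴸ A as → List (Formulaᴹ M l)
      chosen []                            = []
      chosen {𝐚 ∷ _} (𝐚∈A ∷ ps) with type-complete 𝐚∈A
      ... | inj₁ _ = φ⁺ M l k φ 𝐚 ∷ chosen ps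
      ... | inj₂ _ = φ⁻ M l k φ 𝐚 ∷ chosen ps
      chosen-∈ : ∀ {as} (ps : Allᴸ A as) → Allᴸ p (chosen ps)
      chosen-∈ []         = []
      chosen-∈ (𝐚∈A ∷ ps) with type-complete 𝐚∈A
      ... | inj₁ pos = pos ∷ chosen-∈ ps
      ... | inj₂ neg = neg ∷ chosen-∈ ps
      transfer : ∀ {as c} (ps : Allᴸ A as) → Allᴸ (Satᴹ M c) (chosen ps) →
                 Allᴸ (λ 𝐚 → Sat φ (c ++ 𝐚) ⇔ φ⁺ M l k φ 𝐚 ∈ p) as
      transfer []         ss = []
      transfer (𝐚∈A ∷ ps) ss with type-complete 𝐚∈A | ss
      ... | inj₁ pos | s ∷ ss′ = mk⇔ (λ _ → pos) (λ _ → s) ∷ transfer ps ss′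
      ... | inj₂ neg | s ∷ ss′ =
        mk⇔ (λ s′ → contradiction (s s′) lower) (λ pos → conflict consistent pos neg)
        ∷ transfer ps ss′

  type⇒finitely-realized : ∀ {A X : Pred Params ℓ} → X ∈ Sφ M l k φ A →
    X ⊆ A × (∀ as → Allᴸ A as → ∃ λ c → Allᴸ (Agrees X c) as)
  type⇒finitely-realized {A} {X} (p , type , X⊆ , X⊇) = (proj₁ ∘ X⊆) , λ as as∈A →
    let c , gs = type-realized type as as∈A
    in c , Allᴸ.zipWith (λ (g , 𝐚∈A) → mk⇔ (λ s → X⊇ (𝐚∈A , to g s)) (λ 𝐚∈X → from g (proj₂ (X⊆ 𝐚∈X))))
             (gs , as∈A)

  -- Families (𝐛 i), possibly with repetitions

  Range : {I : Set} → (I → Params) → Pred Params ℓ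
  Range 𝐛 𝐚 = ∃ λ i → 𝐛 i ≡ 𝐚

  Trace : {I : Set} → (I → Params) → (I → Bool) → Pred Params ℓ
  Trace 𝐛 χ 𝐚 = ∃ λ i → 𝐛 i ≡ 𝐚 × χ i ≡ true

  Pattern : {I : Set} → (I → Params) → (I → Bool) → Vec Carrier l → I → Set ℓ
  Pattern 𝐛 χ c i = Sat (literal (χ i)) (c ++ 𝐛 i)

  FinitelyRealized : {I : Set} → (I → Params) → (I → Bool) → Set ℓ
  FinitelyRealized 𝐛 χ = ∀ is → ∃ λ c → Allᴸ (Pattern 𝐛 χ c) is

  literal⇔ : ∀ y ρ → Sat (literal y) ρ → Sat φ ρ ⇔ y ≡ true
  literal⇔ true  ρ s = mk⇔ (λ _ → refl) (λ _ → s)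
  literal⇔ false ρ s = mk⇔ (λ s′ → contradiction (s s′) lower) (λ ())

  literal-unique : ∀ x y ρ → Sat (literal x) ρ → Sat (literal y) ρ → x ≡ y
  literal-unique true  true  ρ s s′ = refl
  literal-unique true  false ρ s s′ = contradiction (s′ s) lower
  literal-unique false true  ρ s s′ = contradiction (s s′) lower
  literal-unique false false ρ s s′ = refl

  module _ {I : Set} (𝐛 : I → Params) where

    -- A single c realizes both positions. This is what lets a pattern, a function of the index,
    -- define a subset of the range even when members are repeated, as they may be in an
    -- indiscernible sequence.
    coherent : ∀ {χ} → FinitelyRealized 𝐛 χ → ∀ {i j} → 𝐛 i ≡ 𝐛 j → χ i ≡ χ j
    coherent {χ} realize {i} {j} eq with c , s ∷ s′ ∷ [] ← realize (i ∷ j ∷ []) =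
      literal-unique (χ i) (χ j) _ s (subst (λ 𝐚 → Sat (literal (χ j)) (c ++ 𝐚)) (sym eq) s′)

    ∈-Trace : ∀ {χ} → FinitelyRealized 𝐛 χ → ∀ i → 𝐛 i ∈ Trace 𝐛 χ ⇔ χ i ≡ true
    ∈-Trace realize i = mk⇔
      (λ (j , eq , χⱼ) → trans (coherent realize (sym eq)) χⱼ) (λ χᵢ → i , refl , χᵢ)

    trace-type : ∀ {χ} → FinitelyRealized 𝐛 χ → Trace 𝐛 χ ∈ Sφ M l k φ (Range 𝐛)
    trace-type {χ} realize = finitely-realized⇒type (Range 𝐛) (Trace 𝐛 χ)
      (λ (i , eq , _) → i , eq) λ as as∈ →
        let c , ss = realize (indices as∈) in c , transfer as∈ ss
      where
      indices : ∀ {as} → Allᴸ (Range 𝐛) as → List I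
      indices []             = []
      indices ((i , _) ∷ ps) = i ∷ indices ps
      transfer : ∀ {as c} (ps : Allᴸ (Range 𝐛) as) → Allᴸ (Pattern 𝐛 χ c) (indices ps) →
                 Allᴸ (Agrees (Trace 𝐛 χ) c) as
      transfer []                ss       = []
      transfer ((i , refl) ∷ ps) (s ∷ ss) =
        let g = literal⇔ (χ i) _ s ; h = ∈-Trace realize i
        in mk⇔ (from h ∘ to g) (from g ∘ to h) ∷ transfer ps ss

    trace-injective : ∀ {χ χ′} → FinitelyRealized 𝐛 χ → FinitelyRealized 𝐛 χ′ →
                      Trace 𝐛 χ ≐ Trace 𝐛 χ′ → ∀ i → χ i ≡ χ′ i
    trace-injective {χ} {χ′} r r′ (sub , sup) i with χ i in eq | χ′ i in eq′
    ... | true  | true  = refl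
    ... | false | false = refl
    ... | true  | false = trans (sym (to (∈-Trace r′ i) (sub (from (∈-Trace r i) eq)))) eq′
    ... | false | true  = trans (sym eq) (to (∈-Trace r i) (sup (from (∈-Trace r′ i) eq′)))

    characteristic : Pred Params ℓ → I → Bool
    characteristic X i = does (em {P = 𝐛 i ∈ X})

    ∈-characteristic : ∀ X i → 𝐛 i ∈ X ⇔ characteristic X i ≡ true
    ∈-characteristic X i with em {P = 𝐛 i ∈ X}
    ... | yes 𝐛ᵢ∈X = mk⇔ (λ _ → refl) (λ _ → 𝐛ᵢ∈X)
    ... | no  𝐛ᵢ∉X = mk⇔ (λ 𝐛ᵢ∈X → contradiction 𝐛ᵢ∈X 𝐛ᵢ∉X) (λ ())

    literal-characteristic : ∀ X {c} i → Agrees X c (𝐛 i) → Pattern 𝐛 (characteristic X) c i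
    literal-characteristic X i g with em {P = 𝐛 i ∈ X}
    ... | yes 𝐛ᵢ∈X = from g 𝐛ᵢ∈X
    ... | no  𝐛ᵢ∉X = λ s → lift (𝐛ᵢ∉X (to g s))

    characteristic-realized : ∀ {A X} → X ∈ Sφ M l k φ A → (∀ i → 𝐛 i ∈ A) →
                              FinitelyRealized 𝐛 (characteristic X)
    characteristic-realized {A} {X} X∈S 𝐛∈A is =
      let c , gs = proj₂ (type⇒finitely-realized X∈S) (List.map 𝐛 is) (all is)
      in c , transfer is gs
      where
      all : ∀ is → Allᴸ A (List.map 𝐛 is)
      all []       = []
      all (i ∷ is) = 𝐛∈A i ∷ all is
      transfer : ∀ {c} is → Allᴸ (Agrees X c) (List.map 𝐛 is) →
                 Allᴸ (Pattern 𝐛 (characteristic X) c) is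
      transfer []       []       = []
      transfer (i ∷ is) (g ∷ gs) = literal-characteristic X i g ∷ transfer is gs

    trace-characteristic : ∀ {X} → X ⊆ Range 𝐛 → Trace 𝐛 (characteristic X) ≐ X
    trace-characteristic {X} X⊆ =
      (λ { (i , refl , χᵢ) → from (∈-characteristic X i) χᵢ }) ,
      (λ 𝐚∈X → let i , eq = X⊆ 𝐚∈X in
        i , eq , to (∈-characteristic X i) (subst (_∈ X) (sym eq) 𝐚∈X))

  -- Maximum families from sequences that realize all patterns avoiding u

  HasMaximum : ℕ → Set (lsuc (lsuc ℓ))
  HasMaximum d = ∃ λ A → SubsetHasCard A ℕ × (∃ λ 𝒞 → 𝒞 ∈ Tr M l k φ A × IsMaximumOn A d 𝒞)

  module _ (𝐛 : ℕ → Params) (𝐛-injective : ∀ {i j} → 𝐛 i ≡ 𝐛 j → i ≡ j)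
           (u : List Bool) (d : ℕ) (∣u∣ : length u ≡ suc d)
           (realize : ∀ χ → (∀ m → Avoids u (applyUpTo χ m)) → FinitelyRealized 𝐛 χ) where

    private
      𝒞 : Pred (Pred Params ℓ) (lsuc ℓ)
      𝒞 X = X ∈ Sφ M l k φ (Range 𝐛) ×
            ∃ λ χ → (∀ m → Avoids u (applyUpTo χ m)) × X ≐ Trace 𝐛 χ

      module _ (A : Pred Params ℓ) (n : ℕ) (A⊆ : A ⊆ Range 𝐛) (A-card : SubsetHasCard A (Fin n)) where
        open Bijection A-card using (surjective) renaming (to to enum; injective to enum-injective)

        place : Fin n → ℕ
        place t = proj₁ (A⊆ (proj₂ (enum t)))

        place-𝐛 : ∀ t → 𝐛 (place t) ≡ proj₁ (enum t)
        place-𝐛 t = proj₂ (A⊆ (proj₂ (enum t)))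

        index-of : ∀ {𝐚} → 𝐚 ∈ A → ∃ λ t → proj₁ (enum t) ≡ 𝐚
        index-of 𝐚∈A with t , eq ← surjective (_ , 𝐚∈A) = t , eq refl

        μ : ℕ → Bool
        μ = characteristic 𝐛 A

        μ⇔ : ∀ i → 𝐛 i ∈ A ⇔ μ i ≡ true
        μ⇔ = ∈-characteristic 𝐛 A

        bound : ℕ
        bound = proj₁ (bounded place)

        below-bound : ∀ i → μ i ≡ true → i < bound
        below-bound i μᵢ with t , eq ← index-of (from (μ⇔ i) μᵢ) =
          subst (_< bound) (𝐛-injective (trans (place-𝐛 t) eq)) (proj₂ (bounded place) t)

        positions : ℕ → List ℕ
        positions = select μ id

        count : ∀ m → bound ≤ m → length (positions m) ≡ n
        count m bound≤m = ≤-antisym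
          (injective⇒≤ {f = λ j → proj₁ (enumerated j)} λ {i} {j} eq →
            unique-lookup-injective (select-unique μ id m id) (𝐛-injective
              (trans (sym (proj₂ (enumerated i)))
                (trans (cong (proj₁ ∘ enum) eq) (proj₂ (enumerated j))))))
          (injective⇒≤ {f = λ t → index (listed t)} λ {s} {t} eq → enum-injective
            (trans (sym (place-𝐛 s))
              (trans (cong 𝐛 (index-injective (listed s) (listed t) eq)) (place-𝐛 t))))
          where
          listed : ∀ t → place t ∈ᴸ positions m
          listed t = ∈-select⁺ μ id m (place t) (≤-trans (proj₂ (bounded place) t) bound≤m)
            (to (μ⇔ (place t)) (subst (_∈ A) (sym (place-𝐛 t)) (proj₂ (enum t))))
          enumerated : ∀ j → ∃ λ t → proj₁ (enum t) ≡ 𝐛 (lookupᴸ (positions m) j)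
          enumerated j with i , _ , μᵢ , eq ← ∈-select⁻ μ id m (∈-lookup {xs = positions m} j) =
            index-of (from (μ⇔ _) (trans (cong μ eq) μᵢ))

        word : (ℕ → Bool) → List Bool
        word χ = select μ χ bound

        word-length : ∀ χ m → bound ≤ m → length (select μ χ m) ≡ n
        word-length χ m bound≤m = trans (select-length {Bool} {ℕ} μ χ id m) (count m bound≤m)

        filled : List Bool → ℕ → Bool
        filled w = complete u (mask μ (spread μ w))

        select-spread′ : ∀ {w} → length w ≡ n → ∀ m → bound ≤ m → select μ (spread μ w) m ≡ w
        select-spread′ {w} ∣w∣ m bound≤m = select-spread {ℕ} μ id m w (trans ∣w∣ (sym (count m bound≤m)))

        pattern-avoids : ∀ {w} → w ∈ᴸ avoiding u n → ∀ m → Avoids u (applyUpTo (filled w) m)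
        pattern-avoids {w} w∈ m sub with avoid , ∣w∣ ← avoiding-sound u n w∈ =
          -- A prefix shorter than `bound` may read only a part of w. The longer prefix of length
          -- bound + m reads all of w, and avoidance passes down from it.
          complete-avoids u (mask μ (spread μ w)) (bound + m)
            (subst (Avoids u) (sym (select-spread′ ∣w∣ (bound + m) (m≤m+n bound m))) avoid)
            (⊆-trans sub (applyUpTo-⊑ (filled w) (m≤n+m m bound)))

        pattern-spread : ∀ w i → μ i ≡ true → filled w i ≡ spread μ w i
        pattern-spread w i μᵢ = complete-just u (mask μ (spread μ w)) i
          (cong (λ y → if y then just (spread μ w i) else nothing) μᵢ)

        word-pattern : ∀ {w} → w ∈ᴸ avoiding u n → word (filled w) ≡ w
        word-pattern {w} w∈ = trans
          (select-cong {Bool} μ bound λ i _ → pattern-spread w i)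
          (select-spread′ (proj₂ (avoiding-sound u n w∈)) bound ≤-refl)

        pattern-word : ∀ χ i → μ i ≡ true → filled (word χ) i ≡ χ i
        pattern-word χ i μᵢ = trans (pattern-spread (word χ) i μᵢ)
          (select-injective {Bool} μ bound (select-spread′ (word-length χ bound ≤-refl) bound ≤-refl)
            i (below-bound i μᵢ) μᵢ)

        -- Restricting a pattern to A reads off a subword, which still avoids u. Conversely a word
        -- on A that avoids u is completed by `filled` to a pattern on the whole sequence. So the
        -- traces on A correspond to the words in `avoiding u n`.
        restrictions : FamilyHasCard (Restrict 𝒞 A) (Fin (length (avoiding u n)))
        restrictions = hasCard-list (≐-setoid Params ℓ) (Restrict 𝒞 A)
          (avoiding u n) (avoiding-unique u n) (λ w → Trace 𝐛 (filled w) ∩ A)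
          (λ {w} w∈ → Trace 𝐛 (filled w) ,
            (trace-type 𝐛 (realize _ (pattern-avoids w∈)) ,
             filled w , pattern-avoids w∈ , (id , id)) , (id , id))
          (λ v∈ w∈ eq → trans (sym (word-pattern v∈))
            (trans (select-cong {Bool} μ bound λ i _ → agree v∈ w∈ eq i) (word-pattern w∈)))
          λ (Y , (_ , χ , avoid , Y⊆ , Y⊇) , Z⊆ , Z⊇) → word χ ,
            subst (λ n → word χ ∈ᴸ avoiding u n) (word-length χ bound ≤-refl)
              (avoiding-complete u (word χ) λ sub →
                avoid bound (⊆-trans sub (select-⊑ {Bool} μ χ bound))) ,
            (λ { ((i , refl , y) , 𝐛ᵢ∈A) →
              Z⊇ (Y⊇ (i , refl , trans (sym (pattern-word χ i (to (μ⇔ i) 𝐛ᵢ∈A))) y) , 𝐛ᵢ∈A) }) ,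
            λ z → back χ (Y⊆ (proj₁ (Z⊆ z))) (proj₂ (Z⊆ z))
          where
          back : ∀ χ {𝐚} → 𝐚 ∈ Trace 𝐛 χ → 𝐚 ∈ A → 𝐚 ∈ Trace 𝐛 (filled (word χ)) ∩ A
          back χ (i , refl , y) 𝐛ᵢ∈A = (i , refl , trans (pattern-word χ i (to (μ⇔ i) 𝐛ᵢ∈A)) y) , 𝐛ᵢ∈A
          half : ∀ {v w} → v ∈ᴸ avoiding u n → w ∈ᴸ avoiding u n →
                 Trace 𝐛 (filled v) ∩ A ⊆ Trace 𝐛 (filled w) ∩ A →
                 ∀ i → μ i ≡ true → filled v i ≡ true → filled w i ≡ true
          half v∈ w∈ sub i μᵢ y = to (∈-Trace 𝐛 (realize _ (pattern-avoids w∈)) i)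
            (proj₁ (sub ((i , refl , y) , from (μ⇔ i) μᵢ)))
          agree : ∀ {v w} → v ∈ᴸ avoiding u n → w ∈ᴸ avoiding u n →
                  Trace 𝐛 (filled v) ∩ A ≐ Trace 𝐛 (filled w) ∩ A →
                  ∀ i → μ i ≡ true → filled v i ≡ filled w i
          agree {v} {w} v∈ w∈ (sub , sup) i μᵢ with filled v i in eq | filled w i in eq′
          ... | true  | true  = refl
          ... | false | false = refl
          ... | true  | false = trans (sym (half v∈ w∈ sub i μᵢ eq)) eq′
          ... | false | true  = trans (sym eq) (half w∈ v∈ sup i μᵢ eq′)

    maximum-from-sequence : HasMaximum d
    maximum-from-sequence = Range 𝐛 ,
      record { to = λ i → 𝐛 i , i , refl ; cong = λ { refl → refl }
             ; bijective = 𝐛-injective , λ { (_ , i , refl) → i , λ { refl → refl } } } ,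
      𝒞 , proj₁ ,
      λ A n A⊆ A-card → subst (λ s → FamilyHasCard (Restrict 𝒞 A) (Fin s))
        (trans (avoiding-length u n) (trans (cong (small n) ∣u∣) (sym (choose≤-small n d))))
        (restrictions A n A⊆ A-card)

-- Maxima of sets of natural numbers

module _ (em : ∀ {a} → ExcludedMiddle a) where

  largest : ∀ {a} (P : Pred ℕ a) → P 0 → ∀ n → (∀ d → n ≤ d → ¬ P d) →
            ∃ λ d → IsMaximum P (fin d) × ¬ P (suc d)
  largest P P0 zero    none = contradiction P0 (none 0 z≤n)
  largest P P0 (suc n) none with em {P = P n}
  ... | yes Pn = n , (Pn , λ e Pe → ≮⇒≥ λ n<e → none e n<e Pe) , none (suc n) ≤-refl
  ... | no ¬Pn = largest P P0 n λ d n≤d → case-≤ d (m≤n⇒m<n∨m≡n n≤d)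
    where
    case-≤ : ∀ d → n < d ⊎ n ≡ d → ¬ P d
    case-≤ d (inj₁ n<d)  = none d n<d
    case-≤ d (inj₂ refl) = ¬Pn

  -- The failure at d + 1 is returned along with the maximum, since it is the hypothesis of the
  -- upper bound on the number of types.
  maximum : ∀ {a} (P : Pred ℕ a) → P 0 →
            (∃ λ d → IsMaximum P (fin d) × ¬ P (suc d)) ⊎ IsMaximum P ⊤⁺
  maximum P P0 with em {P = ∃ λ n → ∀ d → n ≤ d → ¬ P d}
  ... | yes (n , none) = inj₁ (largest P P0 n none)
  ... | no  unbounded  = inj₂ λ n → decidable-stable em λ none →
    unbounded (n , λ d n≤d Pd → none (d , n≤d , Pd))

module Density (em : ∀ {a} → ExcludedMiddle a)
             {ℓ} {L : Language ℓ} (M : Structure L) (monster : IsMonster M)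
             (l k : ℕ) (φ : Formula L (l + k)) where
  open Structure M
  open Semantics M
  open Patterns em M l k φ
  open Types em M l k φ

  private
    Params : Set ℓ
    Params = Vec Carrier k

  -- For a fixed c, Ramsey's theorem for single indices makes the truth value y of φ(c,𝐛 i) constant
  -- along a subsequence of distinct tuples. Avoiding the one-letter word `not y` leaves only the
  -- constant pattern y, which c realizes.
  zero-maximum : .{{NonZero k}} → HasMaximum 0
  zero-maximum = from-color (proj₁ (proj₂ colored)) (proj₂ (proj₂ colored))
    where
    𝐛 : ℕ → Params
    𝐛 i = Vec.replicate k (element em M monster i)
    𝐛-injective : ∀ k .{{_ : NonZero k}} {i j} →
      Vec.replicate k (element em M monster i) ≡ Vec.replicate k (element em M monster j) → i ≡ j
    𝐛-injective (suc k) eq = element-injective em M monster (cong Vec.head eq)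
    c : Vec Carrier l
    c = Vec.replicate l nonempty
    colored = ramsey-list em ((1 , λ t → Sat φ (c ++ 𝐛 (Vec.head t))) ∷ [])
    g = proj₁ colored
    constant : (∀ {i j} → i < j → g i < g j) →
               ∀ y → (∀ i → Sat (literal y) (c ++ 𝐛 (g i))) → HasMaximum 0
    constant mono y sat = maximum-from-sequence (𝐛 ∘ g)
      (increasing-injective mono ∘ 𝐛-injective k) (not y ∷ []) 0 refl λ χ avoid is →
        c , Allᴸ.universal (λ i →
          subst (λ y → Sat (literal y) (c ++ 𝐛 (g i))) (sym (χ≡y χ avoid i)) (sat i)) is
      where
      χ≡y : ∀ χ → (∀ m → Avoids (not y ∷ []) (applyUpTo χ m)) → ∀ i → χ i ≡ y
      χ≡y χ avoid i with χ i ≟ᵇ y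
      ... | yes eq = eq
      ... | no neq = contradiction
        (from∈ (subst (_∈ᴸ applyUpTo χ (suc i)) (not-≢ neq) (∈-applyUpTo⁺ χ ≤-refl)))
        (avoid (suc i))
    from-color : (∀ {i j} → i < j → g i < g j) → Allᴸ (Monochromatic em g) _ → HasMaximum 0
    from-color mono (inj₁ all ∷ [])  = constant mono true λ i → all (i ∷ []) (z≤n , _)
    from-color mono (inj₂ none ∷ []) = constant mono false λ i s →
      lift (none (i ∷ []) (z≤n , _) s)

  -- From finite tuples of every length to an infinite sequence

  RealizesAll : ∀ {n} → List Bool → Vec Params n → Set ℓ
  RealizesAll u bs = ∀ w → Avoids u (toList w) → Realized bs w

  realizesAll-tail : ∀ {n} u b (bs : Vec Params n) → RealizesAll u (b ∷ bs) → RealizesAll u bs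
  realizesAll-tail []      b bs r w avoid = contradiction (minimum _) avoid
  realizesAll-tail (x ∷ u) b bs r w avoid =
    -- A letter that does not begin u can be put in front of w without creating an occurrence of u.
    let c , m = r (not x ∷ w) (avoids-fresh (not≢ x) avoid) in c , m ∘ suc

  Avoiding : List Bool → ℕ → Set ℓ
  Avoiding u n = ∃ λ (bs : Vec Params n) → RealizesAll u bs

  avoiding-antitone : ∀ {u m n} → m ≤ n → Avoiding u n → Avoiding u m
  avoiding-antitone {u} {m} {n} m≤n r with m≤n⇒m<n∨m≡n m≤n
  ... | inj₂ refl = r
  avoiding-antitone {u} {m} {suc n} m≤n (b ∷ bs , r) | inj₁ m<n =
    avoiding-antitone (s≤s⁻¹ m<n) (bs , realizesAll-tail u b bs r)

  private
    Extendable : (∀ {n} → Vec Params n → Set ℓ) → ∀ (m : ℕ) {n} → Vec Params n → Set ℓ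
    Extendable R zero    bs = R bs
    Extendable R (suc m) bs = ∃ λ b → Extendable R m (b ∷ bs)

    extend-first : ∀ (R : ∀ {n} → Vec Params n → Set ℓ) m {n} (bs : Vec Params n) →
      Extendable (λ bs → ∃ λ b → R (b ∷ bs)) m bs → Extendable R (suc m) bs
    extend-first R zero    bs r       = r
    extend-first R (suc m) bs (b , e) = b , extend-first R m (b ∷ bs) e

    -- A vector is taken apart at its front, whereas `Extendable` adds the front member last. The
    -- quantifier over the front is therefore moved into R until the empty vector is reached.
    extendable-[] : ∀ (R : ∀ {n} → Vec Params n → Set ℓ) {n} (bs : Vec Params n) →
                    R bs → Extendable R n []
    extendable-[] R         []       r = r
    extendable-[] R {suc n} (b ∷ bs) r =
      extend-first R n [] (extendable-[] (λ bs → ∃ λ b → R (b ∷ bs)) bs (b , r))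

    module Limit (u : List Bool) where
      Ext : ∀ (m : ℕ) {n} → Vec Params n → Set ℓ
      Ext = Extendable (RealizesAll u)

      ext-pred : ∀ m {n} (bs : Vec Params n) → Ext (suc m) bs → Ext m bs
      ext-pred zero    bs (b , r) = realizesAll-tail u b bs r
      ext-pred (suc m) bs (b , e) = b , ext-pred m (b ∷ bs) e

      ext-antitone : ∀ {m m′ n} (bs : Vec Params n) → m ≤ m′ → Ext m′ bs → Ext m bs
      ext-antitone {m} {m′} bs m≤m′ e with m≤n⇒m<n∨m≡n m≤m′
      ... | inj₂ refl = e
      ext-antitone {m} {suc m′} bs m≤m′ e | inj₁ m<m′ =
        ext-antitone bs (s≤s⁻¹ m<m′) (ext-pred m′ bs e)

      avoids? : ∀ {n} (w : Vec Bool n) → Dec (Avoids u (toList w))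
      avoids? w = em

      all-realized : ∀ n → Formula L (n * k)
      all-realized n = ⋀ (mapᴸ realized (filter avoids? (words n)))

      sat-all-realized : ∀ {n} (bs : Vec Params n) → Sat (all-realized n) (concat bs) ⇔ RealizesAll u bs
      sat-all-realized {n} bs = mk⇔
        (λ s w avoid → to (sat-realized bs w)
          (Allᴸ.lookup (to (sat-⋀ em M _ (concat bs)) s)
            (∈-map⁺ realized (∈-filter⁺ avoids? (∈-words w) avoid))))
        (λ r → from (sat-⋀ em M _ (concat bs)) (Allᴸ.map⁺ (Allᴸ.tabulate λ {w} w∈ →
          from (sat-realized bs w) (r w (proj₂ (∈-filter⁻ avoids? {xs = words n} w∈))))))

      extendable : (m n : ℕ) → Formula L (n * k)
      extendable zero    n = all-realized n
      extendable (suc m) n = ∃* k (extendable m (suc n))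

      sat-extendable : ∀ m {n} (bs : Vec Params n) → Sat (extendable m n) (concat bs) ⇔ Ext m bs
      sat-extendable zero    bs = sat-all-realized bs
      sat-extendable (suc m) {n} bs = mk⇔
        (λ s → let b , t = to (sat-∃* em M k (extendable m (suc n)) (concat bs)) s
               in b , to (sat-extendable m (b ∷ bs)) t)
        (λ (b , e) → from (sat-∃* em M k (extendable m (suc n)) (concat bs))
          (b , from (sat-extendable m (b ∷ bs)) e))

      -- Finitely many conditions on b mention finitely many m, and the condition for the largest m
      -- implies the others. A first step of an extension of bs by one member more satisfies it.
      extend : ∀ {n} (bs : Vec Params n) → (∀ m → Ext m bs) → ∃ λ b → ∀ m → Ext m (b ∷ bs)
      extend {n} bs e =
        let b , s = saturation* em M monster k (concat bs) I satisfiable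
        in b , λ m → to (sat-extendable m (b ∷ bs)) (s (m , refl))
        where
        I : Pred (Formula L (k + n * k)) ℓ
        I ψ = ∃ λ m → ψ ≡ extendable m (suc n)
        max : ∀ {Δ} → Allᴸ I Δ → ℕ
        max []             = 0
        max ((m , _) ∷ ps) = m ⊔ max ps
        transfer : ∀ b {Δ m} (ps : Allᴸ I Δ) → max ps ≤ m → Ext m (b ∷ bs) →
                   Allᴸ (λ ψ → Sat ψ (b ++ concat bs)) Δ
        transfer b []                le e = []
        transfer b ((m , refl) ∷ ps) le e =
          from (sat-extendable m (b ∷ bs)) (ext-antitone (b ∷ bs) (≤-trans (m≤m⊔n m (max ps)) le) e) ∷
          transfer b ps (≤-trans (m≤n⊔m m (max ps)) le) e
        satisfiable : FinitelySatisfiable em M monster k (concat bs) I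
        satisfiable Δ ps = let b , e′ = e (suc (max ps)) in b , transfer b ps ≤-refl e′

      module _ (realizable : ∀ n → Avoiding u n) where
        initial : ∀ n → ∃ λ (bs : Vec Params n) → ∀ m → Ext m bs
        initial zero    = [] , λ m → let bs , r = realizable m in extendable-[] (RealizesAll u) bs r
        initial (suc n) = let bs , e = initial n ; b , e′ = extend bs e in b ∷ bs , e′

        limit : ℕ → Params
        limit n = Vec.head (proj₁ (initial (suc n)))

        initial-limit : ∀ n → proj₁ (initial n) ≡ prefix limit n
        initial-limit zero    = refl
        initial-limit (suc n) = cong (limit n ∷_) (initial-limit n)

        limit-realizes : ∀ n → RealizesAll u (prefix limit n)
        limit-realizes n = subst (RealizesAll u) (initial-limit n) (proj₂ (initial n) 0)

  matches-prefix : ∀ {𝐛 : ℕ → Params} {χ c} n → Matches c (prefix 𝐛 n) (prefix χ n) →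
                   ∀ i → i < n → Pattern 𝐛 χ c i
  matches-prefix (suc n) m i i<n with m≤n⇒m<n∨m≡n (s≤s⁻¹ i<n)
  ... | inj₁ i<n′ = matches-prefix n (m ∘ suc) i i<n′
  ... | inj₂ refl = m zero

  -- The limit grows by new elements in front, so it is enumerated backwards,
  -- and the word to be avoided is reversed.
  maximum-from-finite : ∀ d u → length u ≡ suc (suc d) → (∀ n → Avoiding u n) → HasMaximum (suc d)
  maximum-from-finite d u ∣u∣ realizable =
    maximum-from-sequence 𝐛 (injective (reverse u) ∣u∣′ realize) (reverse u) (suc d) ∣u∣′ realize
    where
    open Limit u
    𝐛 : ℕ → Params
    𝐛 = limit realizable
    ∣u∣′ : length (reverse u) ≡ suc (suc d)
    ∣u∣′ = trans (length-reverse u) ∣u∣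
    realize : ∀ χ → (∀ m → Avoids (reverse u) (applyUpTo χ m)) → FinitelyRealized 𝐛 χ
    realize χ avoid is =
      let m , is<m = bounded (lookupᴸ is)
          c , matches = limit-realizes realizable m (prefix χ m) λ sub → avoid m
            (subst (reverse u ⊑_) (reverse-involutive (applyUpTo χ m))
              (reverse⁺ (subst (u ⊑_) (toList-prefix χ m) sub)))
      in c , Allᴸ.tabulate λ {i} i∈ → matches-prefix m matches i
               (subst (_< m) (sym (lookup-index i∈)) (is<m (index i∈)))
    -- The pattern with x at position j, completed so as to avoid u, has `not x` at position i. It
    -- is realized, and equal members would force equal letters. One prescribed letter cannot
    -- contain the two letters x and y, so the completion does avoid u.
    distinct : ∀ x y v → (∀ χ → (∀ m → Avoids (x ∷ y ∷ v) (applyUpTo χ m)) → FinitelyRealized 𝐛 χ) →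
               ∀ {i j} → i < j → ¬ 𝐛 i ≡ 𝐛 j
    distinct x y v realize {i} {j} i<j eq = not≢ x
      (trans (sym (complete-mark x (y ∷ v) x i<j))
        (trans (coherent 𝐛 {χ} (realize χ avoid) {i} {j} eq)
               (complete-just (x ∷ y ∷ v) (mark x j) j (mark-at x j))))
      where
      χ : ℕ → Bool
      χ = complete (x ∷ y ∷ v) (mark x j)
      avoid : ∀ m → Avoids (x ∷ y ∷ v) (applyUpTo χ m)
      avoid m = complete-avoids (x ∷ y ∷ v) (mark x j) m λ sub →
        contradiction (≤-trans (length-mono-≤ sub) (mark-length x j m)) λ { (s≤s ()) }
    injective : ∀ v → length v ≡ suc (suc d) →
      (∀ χ → (∀ m → Avoids v (applyUpTo χ m)) → FinitelyRealized 𝐛 χ) → ∀ {i j} → 𝐛 i ≡ 𝐛 j → i ≡ j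
    injective (x ∷ y ∷ v) ∣v∣ realize {i} {j} eq with <-cmp i j
    ... | tri≈ _ i≡j _ = i≡j
    ... | tri< i<j _ _ = contradiction eq (distinct x y v realize i<j)
    ... | tri> _ _ j<i = contradiction (sym eq) (distinct x y v realize j<i)

  -- Counting types along an indiscernible sequence

  finitelyRealized⇒realized : ∀ {N} (𝐛 : Fin N → Params) χ → FinitelyRealized 𝐛 χ →
                              Realized (tabulate 𝐛) (tabulate χ)
  finitelyRealized⇒realized 𝐛 χ realize =
    let c , ss = realize (allFin _) in c , λ t →
      subst (λ 𝐚 → Sat (literal (lookup (tabulate χ) t)) (c ++ 𝐚)) (sym (lookup∘tabulate 𝐛 t))
        (subst (λ y → Sat (literal y) (c ++ 𝐛 t)) (sym (lookup∘tabulate χ t))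
          (Allᴸ.lookup ss (∈-allFin t)))

  realized⇒finitelyRealized : ∀ {N} (bs : Vec Params N) χ → Realized bs (tabulate χ) →
                              FinitelyRealized (lookup bs) χ
  realized⇒finitelyRealized bs χ (c , matches) is = c , Allᴸ.universal (λ t →
    subst (λ y → Sat (literal y) (c ++ lookup bs t)) (lookup∘tabulate χ t) (matches t)) is

  finitelyRealized-cong : ∀ {I : Set} (𝐛 : I → Params) {χ χ′} → (∀ i → χ i ≡ χ′ i) →
                          FinitelyRealized 𝐛 χ → FinitelyRealized 𝐛 χ′
  finitelyRealized-cong 𝐛 eq realize is =
    let c , ss = realize is
    in c , Allᴸ.map (λ {i} s → subst (λ y → Sat (literal y) (c ++ 𝐛 i)) (eq i) s) ss

  module _ {n N : ℕ} (𝐛 : Fin N → Params) (indiscernible : Indiscernible M 𝐛)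
           {χ : Fin N → Bool} (χ-realized : FinitelyRealized 𝐛 χ) where

    -- Each word w occurs at positions i of its own, along the pattern χ. Indiscernibility, applied
    -- to the formula `realized w`, moves all of these words to one common place, the first n
    -- members.
    realizesAll-target : ∀ a as → target n n a as ⊑ tabulateᴸ χ →
      ∃ λ (bs : Vec Params n) → RealizesAll (mapᴸ not (a ∷ as)) bs
    realizesAll-target a as sub = tabulate (𝐛 ∘ initial) , λ w avoid →
      let i , i-mono , eq = sublist-positions w χ (⊆-trans
            (⊑-target n n a as (toList w) (≤-reflexive (length-toList w)) ≤-refl avoid) sub)
          c , ss = χ-realized (allFin N)
          matches = λ t →
            subst (λ 𝐚 → Sat (literal (lookup w t)) (c ++ 𝐚)) (sym (lookup∘tabulate (𝐛 ∘ i) t))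
              (subst (λ y → Sat (literal y) (c ++ 𝐛 (i t))) (sym (eq t))
                (Allᴸ.lookup ss (∈-allFin (i t))))
      in to (sat-realized (tabulate (𝐛 ∘ initial)) w)
           (to (indiscernible n (realized w) i initial i-mono initial-mono)
             (from (sat-realized (tabulate (𝐛 ∘ i)) w) (c , matches)))
      where
      n≤N : n ≤ N
      n≤N = ≤-trans (target-length n n a as)
        (≤-trans (length-mono-≤ sub) (≤-reflexive (length-tabulate χ)))
      initial : Fin n → Fin N
      initial t = inject≤ t n≤N
      initial-mono : initial Preserves Fin._<_ ⟶ Fin._<_
      initial-mono {s} {t} s<t =
        subst (_< toℕ (initial t)) (sym (toℕ-inject≤ s n≤N))
          (subst (toℕ s <_) (sym (toℕ-inject≤ t n≤N)) s<t)

  finite-obstruction : ∀ d → ¬ HasMaximum (suc d) →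
                       ∃ λ n → ∀ u → length u ≡ suc (suc d) → ¬ Avoiding u n
  finite-obstruction d ¬max = uniform-bound Avoiding (λ {u} → avoiding-antitone {u}) (suc (suc d)) λ u ∣u∣ →
    decidable-stable em λ none → ¬max (maximum-from-finite d u ∣u∣ λ n →
      decidable-stable em λ ¬r → none (n , ¬r))

  module _ {d n : ℕ} (obstruction : ∀ u → length u ≡ suc (suc d) → ¬ Avoiding u n)
           {N : ℕ} (𝐛 : Fin N → Params) (indiscernible : Indiscernible M 𝐛) where

    private
      χ : List Bool → Fin N → Bool
      χ w i = letter w (toℕ i)
      realizes? : ∀ w → Dec (FinitelyRealized 𝐛 (χ w))
      realizes? w = em
      all ws : List (List Bool)
      all = counting n n n (suc d) N
      ws  = filter realizes? all
      ws-realized : ∀ {w} → w ∈ᴸ ws → FinitelyRealized 𝐛 (χ w)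
      ws-realized w∈ = proj₂ (∈-filter⁻ realizes? {xs = all} w∈)
      ws-length : ∀ {w} → w ∈ᴸ ws → length w ≡ N
      ws-length w∈ = counting-length n n n (suc d) N (proj₁ (∈-filter⁻ realizes? {xs = all} w∈))
      pattern∈all : ∀ {χ} → FinitelyRealized 𝐛 χ → tabulateᴸ χ ∈ᴸ all
      pattern∈all {χ} realize with counting-cover n n n (suc d) (tabulateᴸ χ)
      ... | inj₁ w∈ = subst (λ N → tabulateᴸ χ ∈ᴸ counting n n n (suc d) N) (length-tabulate χ) w∈
      ... | inj₂ (a , as , ∣as∣ , sub) = contradiction
        (realizesAll-target 𝐛 indiscernible realize a as
          -- Both counters start at n, so the first block has length n whichever letter it consists
          -- of.
          (subst (λ m → target n m a as ⊑ tabulateᴸ χ) (if-eta a) sub))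
        (obstruction (mapᴸ not (a ∷ as)) (cong suc (trans (length-map not as) ∣as∣)))

    types-counted : ∃ λ s → FamilyHasCard (Sφ M l k φ (range M 𝐛)) (Fin s) ×
                    s ≤ length (counting n n n (suc d) N)
    types-counted = length ws ,
      hasCard-list (≐-setoid Params ℓ) (Sφ M l k φ (range M 𝐛)) ws
        (Unique.filter⁺ realizes? (counting-unique n n n (suc d) N)) (λ w → Trace 𝐛 (χ w))
        (λ w∈ → trace-type 𝐛 (ws-realized w∈))
        (λ {v} {w} v∈ w∈ eq → letter-injective v w (ws-length v∈) (ws-length w∈)
          (trace-injective 𝐛 (ws-realized v∈) (ws-realized w∈) eq))
        (λ {X} X∈S →
          let χX = characteristic 𝐛 X
              realize = characteristic-realized 𝐛 X∈S (λ i → i , refl)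
              X⊆ , X⊇ = trace-characteristic 𝐛 (proj₁ (type⇒finitely-realized X∈S))
          in tabulateᴸ χX ,
             ∈-filter⁺ realizes? (pattern∈all realize)
               (finitelyRealized-cong 𝐛 (λ i → sym (letter-tabulate χX i)) realize) ,
             (λ (i , eq , y) → X⊆ (i , eq , trans (sym (letter-tabulate χX i)) y)) ,
             (λ x → let i , eq , y = X⊇ x in i , eq , trans (letter-tabulate χX i) y)) ,
      length-filter realizes? all

  TypesBoundedBy : ℕ → ℕ → Set (lsuc ℓ)
  TypesBoundedBy K d = ∀ N .{{_ : NonZero N}} (𝐛 : Fin N → Params) → Indiscernible M 𝐛 →
    ∃ λ s → FamilyHasCard (Sφ M l k φ (range M 𝐛)) (Fin s) × s < K * N ^ d

  types-bound : ∀ d → ¬ HasMaximum (suc d) → ∃ λ K → TypesBoundedBy K d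
  types-bound d ¬max =
    let n , obstruction = finite-obstruction d ¬max in with-obstruction n obstruction
    where
    with-obstruction : ∀ n → (∀ u → length u ≡ suc (suc d) → ¬ Avoiding u n) →
                       ∃ λ K → TypesBoundedBy K d
    -- The extra 1 turns the bound by B * N ^ d into a strict one.
    with-obstruction n obstruction = suc B , bound
      where
      B = 2 ^ (n + n) * (growth n d * 2 ^ d)
      bound : TypesBoundedBy (suc B) d
      bound N 𝐛 indiscernible =
        let s , card , s≤ = types-counted obstruction 𝐛 indiscernible
        in s , card , ≤-<-trans (≤-trans s≤ (counting-bound n d N))
                        (*-monoˡ-< (N ^ d) {{m^n≢0 N d}} {B} ≤-refl)

  -- Indiscernible sequences with many types

  module _ (𝐚 : ℕ → Params) (N : ℕ) (Ψ : Pred (Formula L (N * k)) ℓ)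
           (Ψ-true : ∀ {ψ} → ψ ∈ Ψ → ∀ (t : Vec ℕ N) → Increasing 0 t →
                     Sat ψ (concat (Vec.map 𝐚 t))) where

    private
      Swap : Formula L (N * k) → Set ℓ
      Swap ψ = ∃ λ n → ∃ λ (θ : Formula L (n * k)) → ∃₂ λ (i j : Fin n → Fin N) →
        i Preserves Fin._<_ ⟶ Fin._<_ × j Preserves Fin._<_ ⟶ Fin._<_ ×
        ψ ≡ (rename (blocks i) θ ⇒ rename (blocks j) θ)

      Γ : Pred (Formula L (N * k)) ℓ
      Γ ψ = ψ ∈ Ψ ⊎ Swap ψ

      sat-blocks : ∀ {n} (bs : Vec Params N) (i : Fin n → Fin N) θ →
        Sat (rename (blocks i) θ) (concat bs) ⇔ Sat θ (concat (tabulate (lookup bs ∘ i)))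
      sat-blocks bs i θ = subst (λ ρ → Sat (rename (blocks i) θ) (concat bs) ⇔ Sat θ ρ)
        (lookup-blocks bs i) (sat-rename em M (blocks i) θ (concat bs))

      Coloring : Set (lsuc ℓ)
      Coloring = Σ ℕ λ n → Vec ℕ n → Set ℓ

      colorings : ∀ {Δ} → Allᴸ Γ Δ → List Coloring
      colorings []                          = []
      colorings (inj₁ _ ∷ ps)               = colorings ps
      colorings (inj₂ (n , θ , _) ∷ ps)     =
        (n , λ t → Sat θ (concat (Vec.map 𝐚 t))) ∷ colorings ps

      module _ (g : ℕ → ℕ) (g-mono : ∀ {i j} → i < j → g i < g j) where
        bs : Vec Params N
        bs = tabulate (𝐚 ∘ g ∘ toℕ)

        subsequence : ∀ {n} (i : Fin n → Fin N) →
          Vec.map 𝐚 (Vec.map g (tabulate (toℕ ∘ i))) ≡ tabulate (lookup bs ∘ i)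
        subsequence i = trans (cong (Vec.map 𝐚) (sym (tabulate-∘ g (toℕ ∘ i))))
          (trans (sym (tabulate-∘ 𝐚 (g ∘ toℕ ∘ i))) (tabulate-cong λ t → sym (lookup∘tabulate _ (i t))))

        increasing : ∀ {n} (i : Fin n → Fin N) → i Preserves Fin._<_ ⟶ Fin._<_ →
                     Increasing 0 (tabulate (toℕ ∘ i))
        increasing i i-mono = increasing-tabulate (toℕ ∘ i) i-mono (λ _ → z≤n)

        swap : ∀ {n} (θ : Formula L (n * k)) (i j : Fin n → Fin N) →
          i Preserves Fin._<_ ⟶ Fin._<_ → j Preserves Fin._<_ ⟶ Fin._<_ →
          Monochromatic em g (n , λ t → Sat θ (concat (Vec.map 𝐚 t))) →
          Sat (rename (blocks i) θ) (concat bs) → Sat (rename (blocks j) θ) (concat bs)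
        swap θ i j i-mono j-mono (inj₁ all) s = from (sat-blocks bs j θ)
          (subst (Sat θ ∘ concat) (subsequence j) (all _ (increasing j j-mono)))
        swap θ i j i-mono j-mono (inj₂ none) s = contradiction
          (subst (Sat θ ∘ concat) (sym (subsequence i)) (to (sat-blocks bs i θ) s))
          (none _ (increasing i i-mono))

        Δ-true : ∀ {Δ} (ps : Allᴸ Γ Δ) → Allᴸ (Monochromatic em g) (colorings ps) →
                 Allᴸ (λ ψ → Sat ψ (concat bs)) Δ
        Δ-true []                   ms       = []
        Δ-true {ψ ∷ _} (inj₁ ψ∈Ψ ∷ ps) ms    =
          subst (Sat ψ ∘ concat) (trans (subsequence id) (tabulate∘lookup bs))
            (Ψ-true ψ∈Ψ _ (increasing-map g _ g-mono (λ _ → z≤n) (increasing id id))) ∷ Δ-true ps ms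
        Δ-true (inj₂ (n , θ , i , j , i-mono , j-mono , refl) ∷ ps) (m ∷ ms) =
          swap θ i j i-mono j-mono m ∷ Δ-true ps ms

    -- A finite part of Γ mentions only finitely many formulas θ. Ramsey's theorem gives a
    -- subsequence of 𝐚 along which each has a constant truth value, and its first N members satisfy
    -- that part. Implications in one direction are enough, since exchanging i and j gives another
    -- one.
    indiscernible-model : ∃ λ (bs : Vec Params N) → Indiscernible M (lookup bs) ×
                          (∀ {ψ} → ψ ∈ Ψ → Sat ψ (concat bs))
    indiscernible-model with saturation-∅ em M monster (N * k) Γ (λ Δ ps →
      let g , g-mono , ms = ramsey-list em (colorings ps)
      in concat (bs g g-mono) , Δ-true g g-mono ps ms)
    ... | e , realizes with Vec.group N k e
    ...   | bs , refl = bs ,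
      (λ n θ i j i-mono j-mono → mk⇔
        (λ s → to (sat-blocks bs j θ)
          (realizes (inj₂ (n , θ , i , j , i-mono , j-mono , refl)) (from (sat-blocks bs i θ) s)))
        (λ s → to (sat-blocks bs i θ)
          (realizes (inj₂ (n , θ , j , i , j-mono , i-mono , refl)) (from (sat-blocks bs j θ) s)))) ,
      (λ ψ∈Ψ → realizes (inj₁ ψ∈Ψ))

  -- Different patterns define different subsets of the range by `trace-injective`, even if 𝐛 has
  -- repetitions, so the list of types assigns them different numbers.
  patterns≤types : ∀ {m N s} (𝐛 : Fin N → Params) (χ : Fin m → Fin N → Bool) →
    (∀ x → FinitelyRealized 𝐛 (χ x)) → (∀ {x y} → (∀ i → χ x i ≡ χ y i) → x ≡ y) →
    FamilyHasCard (Sφ M l k φ (range M 𝐛)) (Fin s) → m ≤ s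
  patterns≤types {m} {N} {s} 𝐛 χ realize χ-injective card = injective⇒≤ {f = code} code-injective
    where
    open Bijection card using (surjective) renaming (to to type)
    coded : ∀ x → ∃ λ i → proj₁ (type i) ≐ Trace 𝐛 (χ x)
    coded x = let i , eq = surjective (Trace 𝐛 (χ x) , trace-type 𝐛 (realize x)) in i , eq refl
    code : Fin m → Fin s
    code x = proj₁ (coded x)
    transport : ∀ {x i} j → i ≡ j → proj₁ (type j) ≐ Trace 𝐛 (χ x) → proj₁ (type i) ≐ Trace 𝐛 (χ x)
    transport j refl eq = eq
    code-injective : ∀ {x y} → code x ≡ code y → x ≡ y
    code-injective {x} {y} eq = χ-injective (trace-injective 𝐛 (realize x) (realize y)
      (proj₁ eqʸ ∘ proj₂ eqˣ , proj₁ eqˣ ∘ proj₂ eqʸ))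
      where
      eqˣ = proj₂ (coded x)
      eqʸ = transport (code y) eq (proj₂ (coded y))

  RealizedAlong : (ℕ → Params) → ∀ {N} → Vec Bool N → Σ ℕ λ n → Vec ℕ n → Set ℓ
  RealizedAlong 𝐚 {N} w = N , λ t → Realized (Vec.map 𝐚 t) w

  module _ {d : ℕ} (A : Pred Params ℓ) (A-card : SubsetHasCard A ℕ)
           (𝒞 : Pred (Pred Params ℓ) (lsuc ℓ)) (𝒞⊆Sφ : 𝒞 ∈ Tr M l k φ A) (𝒞-max : IsMaximumOn A d 𝒞) (N : ℕ)
           (g : ℕ → ℕ) (g-mono : ∀ {i j} → i < j → g i < g j)
           (colors : Allᴸ (Monochromatic em g)
                          (mapᴸ (RealizedAlong (proj₁ ∘ Bijection.to A-card)) (words N)))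
           where

    private
      𝐚₀ : ℕ → Params
      𝐚₀ i = proj₁ (Bijection.to A-card i)

      𝐚 : ℕ → Params
      𝐚 = 𝐚₀ ∘ g

      𝐚∈A : ∀ i → 𝐚 i ∈ A
      𝐚∈A i = proj₂ (Bijection.to A-card (g i))

      𝐚-injective : ∀ {i j} → 𝐚 i ≡ 𝐚 j → i ≡ j
      𝐚-injective = increasing-injective g-mono ∘ Bijection.injective A-card

      𝐜 : Fin N → Params
      𝐜 i = 𝐚 (toℕ i)

      restricted : FamilyHasCard (Restrict 𝒞 (Range 𝐜)) (Fin (N choose≤ d))
      restricted = 𝒞-max (Range 𝐜) N (λ { (i , refl) → 𝐚∈A (toℕ i) }) record
        { to = λ i → 𝐜 i , i , refl ; cong = λ { refl → refl }
        ; bijective = (λ eq → toℕ-injective (𝐚-injective eq)) ,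
                      λ { (_ , i , refl) → i , λ { refl → refl } } }

      Index : Set
      Index = Fin (N choose≤ d)

      Y : Index → Pred Params ℓ
      Y x = proj₁ (proj₂ (Bijection.to restricted x))

      codeword : Index → Fin N → Bool
      codeword x = characteristic 𝐜 (Y x)

      Y∈Sφ : ∀ x → Y x ∈ Sφ M l k φ A
      Y∈Sφ x = 𝒞⊆Sφ (proj₁ (proj₂ (proj₂ (Bijection.to restricted x))))

      Y-restricted : ∀ x → proj₁ (Bijection.to restricted x) ≐ Y x ∩ Range 𝐜
      Y-restricted x = proj₂ (proj₂ (proj₂ (Bijection.to restricted x)))

      pattern-injective : ∀ {x y} → (∀ i → codeword x i ≡ codeword y i) → x ≡ y
      pattern-injective {x} {y} eq = Bijection.injective restricted (half x y eq , half y x (sym ∘ eq))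
        where
        half : ∀ x y → (∀ i → codeword x i ≡ codeword y i) →
               proj₁ (Bijection.to restricted x) ⊆ proj₁ (Bijection.to restricted y)
        half x y eq z with proj₁ (Y-restricted x) z
        ... | Yx , i , refl = proj₂ (Y-restricted y)
          (from (∈-characteristic 𝐜 (Y y) i)
             (trans (sym (eq i)) (to (∈-characteristic 𝐜 (Y x) i) Yx)) , i , refl)

      pattern-realized : ∀ x → Realized (tabulate 𝐜) (tabulate (codeword x))
      pattern-realized x = finitelyRealized⇒realized 𝐜 (codeword x)
        (characteristic-realized 𝐜 (Y∈Sφ x) (λ i → 𝐚∈A (toℕ i)))

      Ψ : Pred (Formula L (N * k)) ℓ
      Ψ ψ = ∃ λ (x : Index) → ψ ≡ realized (tabulate (codeword x))

      -- The word is realized on the first N members of the subsequence, which rules out the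
      -- negative colour; by homogeneity it is then realized on every increasing N-tuple.
      Ψ-true : ∀ {ψ} → ψ ∈ Ψ → ∀ t → Increasing 0 t → Sat ψ (concat (Vec.map 𝐚 t))
      Ψ-true (x , refl) t inc = from (sat-realized (Vec.map 𝐚 t) w)
        (subst (λ bs → Realized bs w) (sym (map-∘ 𝐚₀ g t)) (always (Allᴸ.lookup
          colors (∈-map⁺ (RealizedAlong 𝐚₀) (∈-words w)))))
        where
        w = tabulate (codeword x)
        first : Vec ℕ N
        first = tabulate toℕ
        first-eq : tabulate 𝐜 ≡ Vec.map 𝐚₀ (Vec.map g first)
        first-eq = trans (tabulate-∘ 𝐚 toℕ) (map-∘ 𝐚₀ g first)
        always : Monochromatic em g (N , λ t → Realized (Vec.map 𝐚₀ t) w) →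
                 Realized (Vec.map 𝐚₀ (Vec.map g t)) w
        always (inj₁ all)  = all t inc
        always (inj₂ none) = contradiction (subst (λ bs → Realized bs w) first-eq (pattern-realized x))
          (none first (increasing-tabulate toℕ id (λ _ → z≤n)))

      patterns-realized : ∀ (bs : Vec Params N) → (∀ {ψ} → ψ ∈ Ψ → Sat ψ (concat bs)) →
                          ∀ x → FinitelyRealized (lookup bs) (codeword x)
      patterns-realized bs sat x = realized⇒finitelyRealized bs (codeword x)
        (to (sat-realized bs (tabulate (codeword x))) (sat (x , refl)))

    many-types-along : ∃ λ (𝐛 : Fin N → Params) → Indiscernible M 𝐛 ×
      (∀ s → FamilyHasCard (Sφ M l k φ (range M 𝐛)) (Fin s) → small N (suc d) ≤ s)
    many-types-along =
      let bs , indiscernible , sat = indiscernible-model 𝐚 N Ψ Ψ-true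
      in lookup bs , indiscernible , λ s card → subst (_≤ s) (choose≤-small N d)
           (patterns≤types (lookup bs) codeword (patterns-realized bs sat) pattern-injective card)

  many-types : ∀ {d} → HasMaximum d → ∀ N → ∃ λ (𝐛 : Fin N → Params) → Indiscernible M 𝐛 ×
    (∀ s → FamilyHasCard (Sφ M l k φ (range M 𝐛)) (Fin s) → small N (suc d) ≤ s)
  many-types (A , A-card , 𝒞 , 𝒞⊆Sφ , 𝒞-max) N =
    let g , g-mono , colors =
          ramsey-list em (mapᴸ (RealizedAlong (proj₁ ∘ Bijection.to A-card)) (words N))
    in many-types-along A A-card 𝒞 𝒞⊆Sφ 𝒞-max N g g-mono colors

  -- The two inequalities

  maximum≤density : ∀ {d} → HasMaximum d → ∀ r → r ∈ VCdInd≤ M l k φ → fromℕ d ≤ᴿ r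
  maximum≤density {d} max r (K , bound) = ≤ᴿ-from-growth em d K r λ N →
    let 𝐛 , indiscernible , many = many-types max N
        s , card , s< = bound N 𝐛 indiscernible
    in s , many s card , s<

  -- A power with real exponent is a supremum over smaller rationals. The bound K · N ^ d thus
  -- serves as a witness with q = d for the exponents strictly above d, and these suffice for the
  -- infimum.
  density≤ : ∀ {d} → ¬ HasMaximum (suc d) → ∀ p → + d ℚ./ 1 ℚ.< p → fromℚ p ∈ VCdInd≤ M l k φ
  density≤ {d} ¬max p d<p =
    let K , bound = types-bound d ¬max
    in K , λ N 𝐛 indiscernible →
      let s , card , s< = bound N 𝐛 indiscernible
      in s , card , + d ℚ./ 1 , d<p , <^ℚ-fromℕ d s<

  density-finite : ∀ {d} → HasMaximum d → ¬ HasMaximum (suc d) → IsVCdInd M l k φ (fin (fromℕ d))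
  density-finite {d} max ¬max = maximum≤density max , greatest
    where
    greatest : ∀ w → (∀ r → r ∈ VCdInd≤ M l k φ → w ≤ᴿ r) → w ≤ᴿ fromℕ d
    greatest w below {p} p∈w =
      let p′ , p<p′ , p′∈w = ℝ.rounded w p∈w
      in ℚ.<-≤-trans p<p′ (ℚ.≮⇒≥ λ d<p′ →
           ℚ.<-irrefl refl (below (fromℚ p′) (density≤ ¬max p′ d<p′) p′∈w))

  density-infinite : IsMaximum HasMaximum ⊤⁺ → IsVCdInd M l k φ ⊤⁺
  density-infinite unbounded = lift λ r r∈ →
    let q , q∉r = ℝ.proper r
        -- A rational is at most the absolute value of its numerator, so this d exceeds q.
        d , q<d , max = unbounded (suc ℤ.∣ ↥ q ∣)
    in q∉r (maximum≤density max r r∈ (<-fromℕ q d q<d))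

theorem3p3 : (∀ {a} → ExcludedMiddle a) →
    ∀ {ℓ} (L : Language ℓ) (T : Theory L) → Complete T →
    (M : Structure L) → M ⊨ T → IsMonster M →
    ∀ (l k : ℕ) .{{_ : NonZero l}} .{{_ : NonZero k}}
    (φ : Formula L (l + k)) →
    ∃ λ v → IsVCm M l k φ v × IsVCdInd M l k φ (fromℕ⁺ v)
theorem3p3 em L T _ M _ monster l k φ
  with maximum em (Types.HasMaximum em M l k φ) (Density.zero-maximum em M monster l k φ)
... | inj₁ (d , max , ¬max) = fin d , max , Density.density-finite em M monster l k φ (proj₁ max) ¬max
... | inj₂ unbounded        = ⊤⁺ , unbounded , Density.density-infinite em M monster l k φ unbounded
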